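{- Every uniform chain $A$ of rank $\omega$ has a representation of the form $\mathcal A(\sigma,\pi)$ for some compatible pair $(\sigma,\pi)$. In particular, a uniform chain $A$ of rank $\omega$ is isomorphic to $\mathcal A(\sigma,\pi)$ whenever $\sigma=\sigma^{A,x}$ and $\pi=\pi^{A,x}$ for some $x\in A$.
   Context: A chain is a linearly ordered set; $\cong$ is order isomorphism. $A+B$ is the ordered sum, $AB=\sum_{b\in B}A$ the anti-lexicographic product; $1$ is the one-element chain. For a chain $A$ define equivalence relations $\rho_\alpha$: $\rho_0$ is equality; $A/\alpha$ is the quotient chain of classes $[x]_\alpha$ (the $\alpha$-components); $x\rho_{\alpha+1}y$ iff the interval between $[x]_\alpha$ and $[y]_\alpha$ in $A/\alpha$ is finite; for limit $\alpha$, $x\rho_\alpha y$ iff $x\rho_\beta y$ for some $\beta<\alpha$. $\mathrm{rk}(A)$ is the least $\alpha$ with $A/\alpha\cong1$. $A$ is uniform if $A^{\ge x}=\{y\in A:x\le y\}$ has the same order type for all $x\in A$. $\mathcal S(\alpha)$ is the set of sequences $s:\alpha\to\alpha$ with $s(i)\le i$ for all $i<\alpha$; $s\restriction k$ is restriction and $t^\frown a$ is $t$ with the entry $a$ appended. For $s\in\mathcal S(n+1)$, $n\ge1$: $s^-=s\restriction n$, and $s^+$ is $s$ with the next-to-last entry $s(n-1)$ deleted (in $\mathcal S(n)$ iff $s(n)<n$). Put $\mathcal A(\langle0\rangle)=1$, $\mathcal A(s)=\mathcal A(s^-)\mathbb Z$ if $s(n)=n$, and $\mathcal A(s)=\mathcal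 A(s^+)+\mathcal A(s^-)\mathbb N$ if $s(n)<n$. By Pastijn's theorem the chains $\mathcal A(s)$, $s\in\mathcal S(n+1)$, exhaust the uniform chains of rank $n$ up to isomorphism. Compatible pairs: let $\sigma\in\mathcal S(\omega+1)$ and $\pi:\omega\to\omega+1$. For $n\in\omega$ let $w_n$ be the least $v$ with $n\le v<\omega$ and $\pi(v)>0$ if such $v$ exists, and $w_n=\omega$ otherwise. The pair $(\sigma,\pi)$ is compatible if (i) for all $k\in\omega$, $\sigma(k)=k$ iff $\pi(k)=\omega$; and (ii) for every $n\in\omega$ with $\pi(n)=0$, $\sigma(w_n)\le n$. The sequence $(s_n)_{n\in\omega}$ derived from $(\sigma,\pi)$ is given by $s_n=\sigma\restriction(n+1)$ if $\pi(n)>0$, and $s_n=(\sigma\restriction n)^\frown\sigma(w_n)$ if $\pi(n)=0$. For a compatible pair $(\sigma,\pi)$ with derived sequence $(s_n)_n$, $\mathcal A(\sigma,\pi)$ denotes the uniform chain of rank $\omega$ obtained as the union (direct limit) of the chains $A_n=\mathcal A(s_n)$ along embeddings $A_n\to A_{n+1}$ mapping $A_n$ isomorphically onto an $n$-component of $A_{n+1}$, as follows: if $\pi(n)<\omega$, then $A_{n+1}/n\cong\mathbb N$ and $A_n$ is mapped onto the $n$-component having exactly $\pi(n)$ predecessor $n$-components in $A_{n+1}$; if $\pi(n)=\omega$, then $A_{n+1}/n\cong\mathbb Z$ and $A_n$ is mapped onto the $0$th $n$-component. For a uniform chain $A$ of rank $\omega$ and $x\in A$: let $s_n\in\mathcal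 S(n+1)$ be such that $[x]_n\cong\mathcal A(s_n)$. The embedding sequence $\pi^{A,x}$ has $\pi^{A,x}(n)=i\in\omega$ if $[x]_{n+1}/n\cong\mathbb N$ and $[x]_n$ has exactly $i$ predecessor $n$-components in $[x]_{n+1}$, and $\pi^{A,x}(n)=\omega$ otherwise (i.e. if $[x]_{n+1}/n\cong\mathbb Z$). The trunk $\sigma^{A,x}\in\mathcal S(\omega+1)$ is given by $\sigma^{A,x}\restriction\omega=\bigcup_n s_{n+1}^-$, with $\sigma^{A,x}(\omega)=s_m(m)$ where $m$ is minimal with $\pi^{A,x}(n)=0$ for all $n\ge m$ if such $m$ exists, and $\sigma^{A,x}(\omega)=\omega$ otherwise.
   Formalization: Condition (i) of compatibility, "σ(k)=k iff π(k)=ω", is replaced by "σ(w_{k+1})=k+1 iff π(k)=ω": as printed, σ(0)=0 forces π(0)=ω, so the uniform chain ω^ω of rank ω, which has no 1-component isomorphic to ℤ, would have no representation. -}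

module Defs where

open import Level using (Level; 0ℓ; _⊔_) renaming (suc to lsuc)
open import Data.Unit.Properties using () renaming (≡-decTotalOrder to ⊤-decTotalOrder)
open import Data.Empty using (⊥)
open import Data.Nat.Base using (ℕ; zero; suc; _≤_; _<_; _≤′_; ≤′-reflexive; ≤′-step; s≤s; _+_; ≤′-refl)
import Data.Nat.Properties as ℕ
open import Data.Integer.Base using (0ℤ)
import Data.Integer.Properties as ℤ
open import Data.Fin.Base using (Fin; zero; suc; toℕ; fromℕ<)
open import Data.Fin.Relation.Unary.Top using (view; ‵fromℕ; ‵inject₁)
open import Data.List.Base using (List; []; _∷_; _++_)
open import Data.List.Relation.Unary.Any using (here)
open import Data.List.Relation.Unary.Any.Properties using (++⁺ˡ; ++⁺ʳ)
import Data.List.Membership.Setoid as Membership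
open import Data.Product.Base using (Σ; Σ-syntax; ∃; ∃-syntax; _×_; _,_; proj₁; proj₂)
open import Data.Product.Relation.Binary.Lex.NonStrict using (×-totalOrder)
open import Data.Sum.Base as Sum using (_⊎_; inj₁; inj₂; swap)
open import Data.Sum.Relation.Binary.LeftOrder using (⊎-<-totalOrder)
open import Function.Base using (_∘_)
open import Function.Bundles using (_⇔_; Bijection)
open import Relation.Binary.Core using (Rel)
open import Relation.Binary.Bundles using (TotalOrder; DecTotalOrder)
open import Relation.Binary.Structures using (IsEquivalence)
open import Relation.Binary.Morphism.Structures using (IsOrderIsomorphism)
import Relation.Binary.Construct.On as On
open import Relation.Binary.PropositionalEquality using (_≡_; refl; sym; trans; cong; subst₂)
import Relation.Binary.PropositionalEquality as ≡
open import Relation.Nullary using (¬_)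
open import Relation.Nullary.Construct.Add.Supremum public using (_⁺; [_]; ⊤⁺)
open import Relation.Binary.Construct.Add.Supremum.NonStrict _≤_ public
  using (_≤⁺_; [_])
open import Relation.Binary.Construct.Add.Supremum.Strict _<_ public
  using (_<⁺_; [_])

private
  variable
    ℓ a b : Level

-- ω+1, with its usual order given by _≤⁺_ and _<⁺_.
ω+1 : Set
ω+1 = ℕ ⁺

pattern ω = ⊤⁺

------------------------------------------------------------------------
-- Chains

-- Equality is a setoid equality, so that quotient chains exist.
Chain : (ℓ : Level) → Set (lsuc ℓ)
Chain ℓ = TotalOrder ℓ ℓ ℓ

∣_∣ : Chain ℓ → Set ℓ
∣_∣ = TotalOrder.Carrier

infix 4 _≅_

record _≅_ (A : Chain a) (B : Chain b) : Set (a ⊔ b) where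
  private
    module A = TotalOrder A
    module B = TotalOrder B
  field
    to                 : ∣ A ∣ → ∣ B ∣
    isOrderIsomorphism : IsOrderIsomorphism A._≈_ B._≈_ A._≤_ B._≤_ to

𝟏 ℕ-chain ℤ-chain : Chain 0ℓ
𝟏       = DecTotalOrder.totalOrder ⊤-decTotalOrder
ℕ-chain = ℕ.≤-totalOrder
ℤ-chain = ℤ.≤-totalOrder

infixl 6 _⊕_
infixl 7 _·ℕ _·ℤ

_⊕_ : Chain ℓ → Chain ℓ → Chain ℓ
A ⊕ B = ⊎-<-totalOrder A B

-- The product is anti-lexicographic: the ℕ- or ℤ-coordinate is compared
-- first, and is therefore written first.
_·ℕ _·ℤ : Chain 0ℓ → Chain 0ℓ
A ·ℕ = ×-totalOrder ℕ.≤-decTotalOrder A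
A ·ℤ = ×-totalOrder ℤ.≤-decTotalOrder A

subchain : (A : Chain ℓ) → (∣ A ∣ → Set ℓ) → Chain ℓ
subchain A P = On.totalOrder A (proj₁ {B = P})

_from_ : (A : Chain ℓ) → ∣ A ∣ → Chain ℓ
A from x = subchain A (TotalOrder._≤_ A x)

Uniform : Chain ℓ → Set ℓ
Uniform A = ∀ x y → A from x ≅ A from y

-- c has exactly i predecessors in C.
HasPredecessors : (C : Chain ℓ) → ∣ C ∣ → ℕ → Set ℓ
HasPredecessors C c i =
  Bijection (≡.setoid (Fin i))
            (TotalOrder.Eq.setoid (subchain C (λ y → y C.≤ c × ¬ (y C.≈ c))))
  where module C = TotalOrder C

------------------------------------------------------------------------
-- Convex equivalences and quotient chains

record ConvexEquivalence (A : Chain ℓ) : Set (lsuc ℓ) where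
  private module A = TotalOrder A
  field
    _~_           : Rel ∣ A ∣ ℓ
    isEquivalence : IsEquivalence _~_
    reflexive     : ∀ {x y} → x A.≈ y → x ~ y
    convex        : ∀ {x y z} → x A.≤ y → y A.≤ z → x ~ z → x ~ y

-- The elements of A / E are those of A; x stands for its class.
infixl 7 _/_
_/_ : (A : Chain ℓ) → ConvexEquivalence A → Chain ℓ
A / E = record
  { Carrier      = ∣ A ∣
  ; _≈_          = _~_
  ; _≤_          = _≲_
  ; isTotalOrder = record
    { isPartialOrder = record
      { isPreorder = record
        { isEquivalence = isEquivalence
        ; reflexive     = inj₂
        ; trans         = ≲-trans
        }
      ; antisym = ≲-antisym
      }
    ; total = λ x y → Sum.map inj₁ inj₁ (A.total x y)
    }
  }
  where
  module A = TotalOrder A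
  open ConvexEquivalence E
  open IsEquivalence isEquivalence renaming (sym to ~-sym; trans to ~-trans) using ()

  _≲_ : Rel ∣ A ∣ _
  x ≲ y = x A.≤ y ⊎ x ~ y

  ≲-trans : ∀ {x y z} → x ≲ y → y ≲ z → x ≲ z
  ≲-trans (inj₁ p) (inj₁ q) = inj₁ (A.trans p q)
  ≲-trans (inj₂ p) (inj₂ q) = inj₂ (~-trans p q)
  ≲-trans {x} {y} {z} (inj₁ p) (inj₂ q) with A.total x z
  ... | inj₁ x≤z = inj₁ x≤z
  ... | inj₂ z≤x = inj₂ (~-sym (convex z≤x p (~-sym q)))
  ≲-trans {x} {y} {z} (inj₂ p) (inj₁ q) with A.total x z
  ... | inj₁ x≤z = inj₁ x≤z
  ... | inj₂ z≤x = inj₂ (~-trans p (convex q z≤x (~-sym p)))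

  ≲-antisym : ∀ {x y} → x ≲ y → y ≲ x → x ~ y
  ≲-antisym (inj₁ p) (inj₁ q) = reflexive (A.antisym p q)
  ≲-antisym (inj₂ p) _        = p
  ≲-antisym (inj₁ _) (inj₂ q) = ~-sym q

module _ (C : Chain ℓ) where
  private module C = TotalOrder C
  open Membership C.Eq.setoid using (_∈_)

  Between : (x y z : ∣ C ∣) → Set ℓ
  Between x y z = (x C.≤ z × z C.≤ y) ⊎ (y C.≤ z × z C.≤ x)

  FiniteInterval : Rel ∣ C ∣ ℓ
  FiniteInterval x y = ∃[ zs ] (∀ z → Between x y z → z ∈ zs)

  finiteInterval-refl : ∀ {x y} → x C.≈ y → FiniteInterval x y
  finiteInterval-refl {x} {y} x≈y = x ∷ [] , λ where
    z (inj₁ (p , q)) → here (C.antisym (C.trans q (C.reflexive (C.Eq.sym x≈y))) p)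
    z (inj₂ (p , q)) → here (C.antisym q (C.trans (C.reflexive x≈y) p))

  finiteInterval-sym : ∀ {x y} → FiniteInterval x y → FiniteInterval y x
  finiteInterval-sym (zs , f) = zs , λ z → f z ∘ swap

  finiteInterval-trans : ∀ {x y z} →
    FiniteInterval x y → FiniteInterval y z → FiniteInterval x z
  finiteInterval-trans {x} {y} {z} (us , f) (vs , g) = us ++ vs , h
    where
    h : ∀ w → Between x z w → w ∈ us ++ vs
    h w b with C.total w y | b
    ... | inj₁ w≤y | inj₁ (x≤w , _) = ++⁺ˡ (f w (inj₁ (x≤w , w≤y)))
    ... | inj₂ y≤w | inj₁ (_ , w≤z) = ++⁺ʳ us (g w (inj₁ (y≤w , w≤z)))
    ... | inj₁ w≤y | inj₂ (z≤w , _) = ++⁺ʳ us (g w (inj₂ (z≤w , w≤y)))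
    ... | inj₂ y≤w | inj₂ (_ , w≤x) = ++⁺ˡ (f w (inj₂ (y≤w , w≤x)))

  finiteInterval-convex : ∀ {x y z} →
    x C.≤ y → y C.≤ z → FiniteInterval x z → FiniteInterval x y
  finiteInterval-convex x≤y y≤z (zs , f) = zs , λ where
    w (inj₁ (x≤w , w≤y)) → f w (inj₁ (x≤w , C.trans w≤y y≤z))
    w (inj₂ (y≤w , w≤x)) → f w (inj₁ (C.trans x≤y y≤w , C.trans w≤x (C.trans x≤y y≤z)))

-- The relations ρ_α for α ≤ ω.

ρ-suc : {A : Chain ℓ} → ConvexEquivalence A → ConvexEquivalence A
ρ-suc {A = A} E = record
  { _~_           = FiniteInterval (A / E)
  ; isEquivalence = record
    { refl  = finiteInterval-refl (A / E) (IsEquivalence.refl E.isEquivalence)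
    ; sym   = finiteInterval-sym (A / E)
    ; trans = finiteInterval-trans (A / E)
    }
  ; reflexive     = finiteInterval-refl (A / E) ∘ E.reflexive
  ; convex        = λ p q → finiteInterval-convex (A / E) (inj₁ p) (inj₁ q)
  }
  where module E = ConvexEquivalence E

ρ-fin : (A : Chain ℓ) → ℕ → ConvexEquivalence A
ρ-fin A zero = record
  { _~_           = A._≈_
  ; isEquivalence = A.isEquivalence
  ; reflexive     = λ p → p
  ; convex        = λ x≤y y≤z x≈z →
      A.antisym x≤y (A.trans y≤z (A.reflexive (A.Eq.sym x≈z)))
  }
  where module A = TotalOrder A
ρ-fin A (suc n) = ρ-suc (ρ-fin A n)

ρ : (A : Chain ℓ) → ω+1 → ConvexEquivalence A
ρ A [ n ] = ρ-fin A n
ρ A ω = record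
  { _~_           = λ x y → ∃[ n ] (x ~[ n ] y)
  ; isEquivalence = record
    { refl  = 0 , A.Eq.refl
    ; sym   = λ (n , p) → n , IsEquivalence.sym (isEq n) p
    ; trans = λ (m , p) (n , q) →
        m + n
        , IsEquivalence.trans (isEq (m + n))
            (raise (ℕ.≤⇒≤′ (ℕ.m≤m+n m n)) p) (raise (ℕ.≤⇒≤′ (ℕ.m≤n+m n m)) q)
    }
  ; reflexive     = λ p → 0 , p
  ; convex        = λ p q (n , r) → n , ConvexEquivalence.convex (ρ-fin A n) p q r
  }
  where
  module A = TotalOrder A
  _~[_]_ : ∣ A ∣ → ℕ → ∣ A ∣ → Set _
  x ~[ n ] y = ConvexEquivalence._~_ (ρ-fin A n) x y

  isEq : ∀ n → IsEquivalence (λ x y → x ~[ n ] y)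
  isEq n = ConvexEquivalence.isEquivalence (ρ-fin A n)

  raise : ∀ {m n x y} → m ≤′ n → x ~[ m ] y → x ~[ n ] y
  raise (≤′-reflexive refl) p = p
  raise (≤′-step {n} m≤n)   p = finiteInterval-refl (A / ρ-fin A n) (raise m≤n p)

HasRank : Chain ℓ → ω+1 → Set ℓ
HasRank A α = (A / ρ A α ≅ 𝟏) × (∀ β → β <⁺ α → ¬ (A / ρ A β ≅ 𝟏))

-- [x]_n as a subchain.
component : (A : Chain ℓ) → ℕ → ∣ A ∣ → Chain ℓ
component A n x = subchain A (ConvexEquivalence._~_ (ρ A [ n ]) x)

centre : (A : Chain ℓ) (n : ℕ) (x : ∣ A ∣) → ∣ component A n x ∣
centre A n x = x , IsEquivalence.refl (ConvexEquivalence.isEquivalence (ρ A [ n ]))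

------------------------------------------------------------------------
-- Sequences

-- 𝒮(n) for finite n: the entry at position n is an element of
-- {0,…,n} = Fin (suc n).
infixl 5 _⌢_

data 𝒮 : ℕ → Set where
  ⟨⟩  : 𝒮 0
  _⌢_ : ∀ {n} → 𝒮 n → Fin (suc n) → 𝒮 (suc n)

_⁻ : ∀ {n} → 𝒮 (suc n) → 𝒮 n
(s ⌢ _) ⁻ = s

last : ∀ {n} → 𝒮 (suc n) → Fin (suc n)
last (_ ⌢ a) = a

-- 𝒮(ω+1).
record 𝒮ω+1 : Set where
  field
    at      : ω+1 → ω+1
    bounded : ∀ i → at i ≤⁺ i

open 𝒮ω+1 public

lower : ∀ {n} (j : ω+1) → j ≤⁺ [ n ] → Fin (suc n)
lower [ j ] [ j≤n ] = fromℕ< (s≤s j≤n)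

_↾_ : 𝒮ω+1 → (n : ℕ) → 𝒮 n
σ ↾ zero  = ⟨⟩
σ ↾ suc n = (σ ↾ n) ⌢ lower (at σ [ n ]) (bounded σ [ n ])

------------------------------------------------------------------------
-- The chains 𝒜(s)

-- For s = t ⌢ b ⌢ a in 𝒮(n+2): either a is the top element n+1, or a = a′
-- is at most n and s⁺ = t ⌢ a′.
𝒜 : ∀ {n} → 𝒮 (suc n) → Chain 0ℓ
𝒜 (⟨⟩ ⌢ zero) = 𝟏
𝒜 (t ⌢ b ⌢ a) with view a
... | ‵fromℕ      = 𝒜 (t ⌢ b) ·ℤ
... | ‵inject₁ a′ = 𝒜 (t ⌢ a′) ⊕ 𝒜 (t ⌢ b) ·ℕ

-- x lies in the 0th component of 𝒜(s) = 𝒜(s⁻)ℤ.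
Zeroth : ∀ {n} (s : 𝒮 (suc (suc n))) → ∣ 𝒜 s ∣ → Set
Zeroth (t ⌢ b ⌢ a) x with view a
... | ‵fromℕ      = proj₁ x ≡ 0ℤ
... | ‵inject₁ a′ = ⊥

------------------------------------------------------------------------
-- Compatible pairs and derived sequences

-- IsNextPositive π n w says that w = w_n.
IsNextPositive : (ℕ → ω+1) → ℕ → ω+1 → Set
IsNextPositive π n [ v ] =
  n ≤ v × [ 0 ] <⁺ π v × (∀ u → n ≤ u → [ 0 ] <⁺ π u → v ≤ u)
IsNextPositive π n ω     = ∀ v → n ≤ v → ¬ ([ 0 ] <⁺ π v)

-- Condition top⇔ω says that 𝒜(s_{k+1})/k ≅ ℤ iff π(k) = ω for the derived
-- sequence: 𝒜(s_{k+1})/k ≅ ℤ iff s_{k+1}(k+1) = k+1, and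
-- s_{k+1}(k+1) = σ(w_{k+1}), which is σ(k+1) if π(k+1) > 0.  The condition
-- "σ(k) = k iff π(k) = ω" would not do: σ(0) = 0 always, so it would force
-- π(0) = ω and exclude the ordinal ω^ω, whose embedding sequence at the
-- point 0 is identically 0.
record Compatible (σ : 𝒮ω+1) (π : ℕ → ω+1) : Set where
  field
    top⇔ω  : ∀ k w → IsNextPositive π (suc k) w → at σ w ≡ [ suc k ] ⇔ π k ≡ ω
    zero⇒≤ : ∀ n → π n ≡ [ 0 ] → ∀ w → IsNextPositive π n w → at σ w ≤⁺ [ n ]

record Derived {σ : 𝒮ω+1} {π : ℕ → ω+1} (c : Compatible σ π)
               (s : ∀ n → 𝒮 (suc n)) : Set where
  field
    positive : ∀ n → [ 0 ] <⁺ π n → s n ≡ σ ↾ suc n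
    null     : ∀ n (πn≡0 : π n ≡ [ 0 ]) w (next : IsNextPositive π n w) →
               s n ≡ (σ ↾ n) ⌢ lower (at σ w) (Compatible.zero⇒≤ c n πn≡0 w next)

------------------------------------------------------------------------
-- Direct limits

-- c n represents the n-component of A (suc n) onto which A n is mapped.
module DirectLimit (A : ℕ → Chain ℓ)
                   (c : ∀ n → ∣ A (suc n) ∣)
                   (iso : ∀ n → A n ≅ component (A (suc n)) n (c n)) where

  private
    module A n = TotalOrder (A n)
    module Iso n = IsOrderIsomorphism (_≅_.isOrderIsomorphism (iso n))

  embed : ∀ n → ∣ A n ∣ → ∣ A (suc n) ∣
  embed n x = proj₁ (_≅_.to (iso n) x)

  up : ∀ {m n} → m ≤′ n → ∣ A m ∣ → ∣ A n ∣
  up (≤′-reflexive refl) x = x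
  up (≤′-step {n} m≤n)   x = embed n (up m≤n x)

  -- The images of two elements in some later A k are related.
  Eventually : (∀ k → Rel ∣ A k ∣ ℓ) → Rel (Σ[ n ∈ ℕ ] ∣ A n ∣) ℓ
  Eventually R (m , x) (n , y) =
    ∃[ k ] Σ[ p ∈ m ≤′ k ] Σ[ q ∈ n ≤′ k ] R k (up p x) (up q y)

  up-irrelevant : ∀ {m n} (p q : m ≤′ n) x → up p x ≡ up q x
  up-irrelevant (≤′-reflexive refl) (≤′-reflexive refl) x = refl
  up-irrelevant (≤′-reflexive refl) (≤′-step q) x
    with () ← ℕ.<-irrefl refl (ℕ.≤′⇒≤ q)
  up-irrelevant (≤′-step p) (≤′-reflexive refl) x
    with () ← ℕ.<-irrefl refl (ℕ.≤′⇒≤ p)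
  up-irrelevant (≤′-step {n} p) (≤′-step q) x = cong (embed n) (up-irrelevant p q x)

  up-trans : ∀ {l m n} (p : l ≤′ m) (q : m ≤′ n) x →
             up (ℕ.≤′-trans p q) x ≡ up q (up p x)
  up-trans p (≤′-reflexive refl) x = refl
  up-trans p (≤′-step {n} q)     x = cong (embed n) (up-trans p q x)

  up-factor : ∀ {l m n} (p : l ≤′ m) (q : m ≤′ n) (r : l ≤′ n) x →
              up q (up p x) ≡ up r x
  up-factor p q r x = trans (sym (up-trans p q x)) (up-irrelevant (ℕ.≤′-trans p q) r x)

  Preserved : (∀ k → Rel ∣ A k ∣ ℓ) → Set ℓ
  Preserved R = ∀ {m n} (p : m ≤′ n) {x y} → R m x y → R n (up p x) (up p y)

  up-mono : Preserved A._≤_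
  up-mono (≤′-reflexive refl) x≤y = x≤y
  up-mono (≤′-step {n} p)     x≤y = Iso.mono n (up-mono p x≤y)

  up-cong : Preserved A._≈_
  up-cong (≤′-reflexive refl) x≈y = x≈y
  up-cong (≤′-step {n} p)     x≈y = Iso.cong n (up-cong p x≈y)

  later : ∀ {R} → Preserved R → ∀ {m n k l x y} (p : m ≤′ k) (q : n ≤′ k) →
          R k (up p x) (up q y) → k ≤′ l → (p′ : m ≤′ l) (q′ : n ≤′ l) →
          R l (up p′ x) (up q′ y)
  later {R} pres {l = l} {x} {y} p q r k≤l p′ q′ =
    subst₂ (R l) (up-factor p k≤l p′ x) (up-factor q k≤l q′ y) (pres k≤l r)

  join : ∀ {R S T} → Preserved R → Preserved S →
         ∀ {l m n x y z} →
         (∀ k {x y z} → R k x y → S k y z → T k x z) →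
         Eventually R (l , x) (m , y) → Eventually S (m , y) (n , z) →
         Eventually T (l , x) (n , z)
  join {R} {S} presR presS comp (k , p , q , r) (k′ , q′ , p′ , s) =
    k + k′ , lp , np
    , comp (k + k′) (later {R} presR p q r k≤ lp mp) (later {S} presS q′ p′ s k′≤ mp np)
    where
    k≤ : k ≤′ k + k′
    k≤ = ℕ.m≤′m+n k k′
    k′≤ : k′ ≤′ k + k′
    k′≤ = ℕ.n≤′m+n k k′
    lp = ℕ.≤′-trans p k≤
    mp = ℕ.≤′-trans q k≤
    np = ℕ.≤′-trans p′ k′≤

  antisym : ∀ {u v} → Eventually A._≤_ u v → Eventually A._≤_ v u → Eventually A._≈_ u v
  antisym (k , p , q , r) (k′ , q′ , p′ , s) =
    k + k′ , up₁ , up₂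
    , A.antisym (k + k′)
        (later {A._≤_} up-mono p q r (ℕ.m≤′m+n k k′) up₁ up₂)
        (later {A._≤_} up-mono q′ p′ s (ℕ.n≤′m+n k k′) up₂ up₁)
    where
    up₁ = ℕ.≤′-trans p (ℕ.m≤′m+n k k′)
    up₂ = ℕ.≤′-trans q (ℕ.m≤′m+n k k′)

  total : ∀ u v → Eventually A._≤_ u v ⊎ Eventually A._≤_ v u
  total (m , x) (n , y) = Sum.map (λ r → m + n , p , q , r) (λ r → m + n , q , p , r)
                                  (A.total (m + n) (up p x) (up q y))
    where
    p = ℕ.m≤′m+n m n
    q = ℕ.n≤′m+n m n

  lim : Chain ℓ
  lim = record
    { Carrier      = Σ[ n ∈ ℕ ] ∣ A n ∣
    ; _≈_          = Eventually A._≈_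
    ; _≤_          = Eventually A._≤_
    ; isTotalOrder = record
      { isPartialOrder = record
        { isPreorder = record
          { isEquivalence = record
            { refl  = λ {(n , x)} → n , ≤′-refl , ≤′-refl , A.Eq.refl n
            ; sym   = λ (k , p , q , r) → k , q , p , A.Eq.sym k r
            ; trans = join {A._≈_} {A._≈_} {A._≈_} up-cong up-cong A.Eq.trans
            }
          ; reflexive = λ (k , p , q , r) → k , p , q , A.reflexive k r
          ; trans     = join {A._≤_} {A._≤_} {A._≤_} up-mono up-mono (λ k → A.trans k)
          }
        ; antisym = antisym
        }
      ; total = total
      }
    }

------------------------------------------------------------------------
-- The chains 𝒜(σ,π)

-- The position of the n-component does not determine the isomorphism onto
-- it, so the embeddings are part of the data.
record System {σ : 𝒮ω+1} {π : ℕ → ω+1} (c : Compatible σ π) : Set where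
  field
    s       : ∀ n → 𝒮 (suc n)
    derived : Derived c s
    target  : ∀ n → ∣ 𝒜 (s (suc n)) ∣
    iso     : ∀ n → 𝒜 (s n) ≅ component (𝒜 (s (suc n))) n (target n)
    finite  : ∀ n i → π n ≡ [ i ] →
              let Q = 𝒜 (s (suc n)) / ρ _ [ n ] in
              Q ≅ ℕ-chain × HasPredecessors Q (target n) i
    infinite : ∀ n → π n ≡ ω →
               𝒜 (s (suc n)) / ρ _ [ n ] ≅ ℤ-chain × Zeroth (s (suc n)) (target n)

  limit : Chain 0ℓ
  limit = DirectLimit.lim (λ n → 𝒜 (s n)) target iso

-- A ≅ 𝒜(σ,π): suitable embeddings exist, and A is isomorphic to the direct
-- limit whichever of them are chosen.
infix 4 _≅𝒜[_]
_≅𝒜[_] : Chain ℓ → {σ : 𝒮ω+1} {π : ℕ → ω+1} → Compatible σ π → Set ℓ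
A ≅𝒜[ c ] = System c × (∀ (S : System c) → A ≅ System.limit S)

------------------------------------------------------------------------
-- Embedding sequence and trunk

-- [x]_{n+1}/n ≅ ℕ and [x]_n has exactly i predecessors in it.
Predecessors : (A : Chain ℓ) → ∣ A ∣ → ℕ → ℕ → Set ℓ
Predecessors A x n i =
  let Q = component A (suc n) x / ρ _ [ n ] in
  Q ≅ ℕ-chain × HasPredecessors Q (centre A (suc n) x) i

-- π = π^{A,x}.
record IsEmbeddingSequence (A : Chain ℓ) (x : ∣ A ∣) (π : ℕ → ω+1) : Set ℓ where
  field
    finite   : ∀ n i → π n ≡ [ i ] → Predecessors A x n i
    infinite : ∀ n → π n ≡ ω → ∀ i → ¬ Predecessors A x n i

IsLeastNullFrom : (ℕ → ω+1) → ℕ → Set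
IsLeastNullFrom π m = NullFrom m × (∀ k → NullFrom k → m ≤ k)
  where
  NullFrom : ℕ → Set
  NullFrom k = ∀ n → k ≤ n → π n ≡ [ 0 ]

-- σ = σ^{A,x}, where π = π^{A,x}.
record IsTrunk (A : Chain ℓ) (x : ∣ A ∣) (π : ℕ → ω+1) (σ : 𝒮ω+1) : Set ℓ where
  field
    s      : ∀ n → 𝒮 (suc n)
    iso    : ∀ n → component A n x ≅ 𝒜 (s n)
    below  : ∀ n → σ ↾ suc n ≡ s (suc n) ⁻
    top    : ∀ m → IsLeastNullFrom π m → at σ ω ≡ [ toℕ (last (s m)) ]
    topω   : (∀ m → ¬ IsLeastNullFrom π m) → at σ ω ≡ ω

module Submission where

-- Fix a point x of a uniform chain A of rank ω.  Since x ρ_n y for some n, for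
-- every y, the chain A is the union of the components [x]_n, and it is
-- represented by 𝒜(σ,π) as soon as the tower of these components is isomorphic
-- to the direct system (A_n), step by step.  An isomorphism [x]_n ≅ A_n
-- extends to [x]_{n+1} ≅ A_{n+1} in the following way (extend).  The number of
-- predecessors determines which n-component of A_{n+1} is the image of [x]_n
-- if A_{n+1}/n ≅ ℕ; if A_{n+1}/n ≅ ℤ then any n-component can be moved to any
-- other by a shift.  So there is an isomorphism g : [x]_{n+1} ≅ A_{n+1} which
-- maps [x]_n onto the right component, and g may be overridden on [x]_n by the
-- given isomorphism.
--
-- Everything else is about n-components.  They are preserved and reflected by
-- convex embeddings (preserve, reflect).  The n-components of 𝒜(t ⌢ b ⌢ a) are
-- the summands in its definition (𝒜-shape), because a chain 𝒜(s) of positive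
-- rank has no last component of the next lower rank, so adjacent summands do
-- not merge.  A chain is determined by the arrangement of its n-components
-- (ℤ-Shape-unique, ℕ-Shape-unique), and conversely s is determined by 𝒜(s)
-- (𝒜-injective).  Hence for π = π^{A,x} and σ = σ^{A,x} the sequence s in the
-- definition of the trunk satisfies s_n = σ ↾ (n+1) if π(n) > 0, and s_n and
-- s_{n+1} have the same last entry if π(n) = 0.  So the last entry of s_n is
-- σ(w_n) (at-next); therefore (σ,π) is compatible and s is its derived
-- sequence.
--
-- Trunks exist by Pastijn's theorem (pastijn).  By rank ω and uniformity no
-- [x]_{n+1} has a last n-component, so that [x]_{n+1}/n, being locally finite,
-- is isomorphic to ℕ or ℤ.  The second n-component of the final segment
-- { y : x ≤ y } does not depend on x up to isomorphism, so all n-components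
-- with an immediate predecessor are isomorphic to one chain 𝒜(t ⌢ b)
-- (covered-≅).  By induction there is one t for which every n-component is
-- isomorphic to some 𝒜(t ⌢ a), and [x]_{n+1} is then isomorphic to
-- 𝒜(t ⌢ b ⌢ a) for some a.

open import Defs
open import Level using (Level; 0ℓ; _⊔_; Lift; lift)
import Algebra.Properties.AbelianGroup
open import Axiom.ExcludedMiddle using (ExcludedMiddle)
open import Data.Fin.Base using (Fin; zero; suc; toℕ; fromℕ<; fromℕ; inject₁)
import Data.Fin.Properties as Fin
open import Data.Fin.Relation.Unary.Top using (view; ‵fromℕ; ‵inject₁)
open import Data.Integer.Base as ℤ using (ℤ; +_; -[1+_]; +≤+; -≤+; -≤-; 0ℤ)
import Data.Integer.Properties as ℤ
open import Data.List.Base using (List; []; _∷_; map)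
open import Data.List.Relation.Unary.Any as Any using (Any; here; there)
open import Data.List.Relation.Unary.Any.Properties using (map⁺)
open import Data.Nat.Base as ℕ using (ℕ; zero; suc; _≤′_; ≤′-reflexive; ≤′-step; z≤n; s≤s)
import Data.Nat.Properties as ℕ
open import Data.Product.Base using (Σ-syntax; ∃-syntax; _×_; _,_; proj₁; proj₂)
open import Data.Sum.Base as Sum using (_⊎_; inj₁; inj₂)
open import Data.Sum.Relation.Binary.LeftOrder using (₁∼₂; ₁∼₁; ₂∼₂)
open import Data.Sum.Relation.Binary.Pointwise using (inj₁; inj₂)
open import Data.Unit.Base using (⊤; tt)
open import Function.Base using (_∘_; id)
open import Function.Bundles using (Bijection; mk⇔; _⇔_)
open import Relation.Binary.Bundles using (TotalOrder)
open import Relation.Binary.Construct.Add.Supremum.NonStrict ℕ._≤_ using (_≤⊤⁺)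
open import Relation.Binary.Construct.Add.Supremum.Strict ℕ._<_ using ([_]<⊤⁺)
import Relation.Binary.Construct.Flip.EqAndOrd as Flip
open import Relation.Binary.Definitions using (tri<; tri≈; tri>)
open import Relation.Binary.Morphism.Structures using (IsOrderIsomorphism)
open import Relation.Binary.PropositionalEquality using (_≡_; _≢_; refl; sym; trans; cong; cong₂; subst)
open import Relation.Binary.Structures using (IsEquivalence)
open import Relation.Nullary using (¬_; Dec; yes; no; contradiction)
open import Relation.Nullary.Construct.Add.Supremum using ([]-injective)
import Relation.Nullary.Decidable as Dec

private
  variable
    a b b′ c d ℓ : Level

-- The chains 𝒜(s) live in the lowest universe, A in an arbitrary one.
lowerEM : ∀ b → ExcludedMiddle (a ⊔ b) → ExcludedMiddle a
lowerEM b em {P} = Dec.map′ Lift.lower lift (em {Lift b P})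

-- Order isomorphisms

infix 4 _⊢_≤_ _⊢_≈_ _⊢_~[_]_

_⊢_≤_ _⊢_≈_ : (A : Chain a) → ∣ A ∣ → ∣ A ∣ → Set a
A ⊢ x ≤ y = TotalOrder._≤_ A x y
A ⊢ x ≈ y = TotalOrder._≈_ A x y

-- The relation ρ_n of A.
_⊢_~[_]_ : (A : Chain a) → ∣ A ∣ → ℕ → ∣ A ∣ → Set a
A ⊢ x ~[ n ] y = ConvexEquivalence._~_ (ρ-fin A n) x y

-- The quotient A / n.
_/ρ_ : Chain a → ℕ → Chain a
A /ρ n = A / ρ-fin A n

-- The components of an isomorphism, and its inverse.
module Iso {a b} {A : Chain a} {B : Chain b} (e : A ≅ B) where
  private module B = TotalOrder B
  open _≅_ e public using (to)
  open IsOrderIsomorphism (_≅_.isOrderIsomorphism e) public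
    using (cong; mono; injective; cancel; surjective)

  from : ∣ B ∣ → ∣ A ∣
  from y = proj₁ (surjective y)

  to-from : ∀ y → B ⊢ to (from y) ≈ y
  to-from y = proj₂ (surjective y) (TotalOrder.Eq.refl A)

mkIso : (A : Chain a) (B : Chain b) (f : ∣ A ∣ → ∣ B ∣) →
        (∀ x y → A ⊢ x ≤ y → B ⊢ f x ≤ f y) →
        (∀ x y → B ⊢ f x ≤ f y → A ⊢ x ≤ y) →
        (∀ y → ∃[ x ] B ⊢ f x ≈ y) →
        A ≅ B
mkIso A B f mono cancel onto = record
  { to                 = f
  ; isOrderIsomorphism = record
    { isOrderMonomorphism = record
      { isOrderHomomorphism = record { cong = f-cong ; mono = mono _ _ }
      ; injective           = λ p → A.antisym (cancel _ _ (B.reflexive p))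
                                              (cancel _ _ (B.reflexive (B.Eq.sym p)))
      ; cancel              = cancel _ _
      }
    ; surjective = λ y → proj₁ (onto y) , λ p → B.Eq.trans (f-cong p) (proj₂ (onto y))
    }
  }
  where
  module A = TotalOrder A
  module B = TotalOrder B
  f-cong : ∀ {x y} → A ⊢ x ≈ y → B ⊢ f x ≈ f y
  f-cong p = B.antisym (mono _ _ (A.reflexive p)) (mono _ _ (A.reflexive (A.Eq.sym p)))

-- As the orders are total, a monotone injection reflects the order.
mkIso-injective : (A : Chain a) (B : Chain b) (f : ∣ A ∣ → ∣ B ∣) →
                  (∀ x y → A ⊢ x ≤ y → B ⊢ f x ≤ f y) →
                  (∀ x y → A ⊢ x ≤ y → B ⊢ f x ≈ f y → A ⊢ x ≈ y) →
                  (∀ y → ∃[ x ] B ⊢ f x ≈ y) →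
                  A ≅ B
mkIso-injective A B f mono injective = mkIso A B f mono cancel
  where
  module A = TotalOrder A
  module B = TotalOrder B
  cancel : ∀ x y → B ⊢ f x ≤ f y → A ⊢ x ≤ y
  cancel x y fx≤fy with A.total x y
  ... | inj₁ x≤y = x≤y
  ... | inj₂ y≤x = A.reflexive (A.Eq.sym
                     (injective y x y≤x (B.antisym (mono y x y≤x) fx≤fy)))

≅-sym : {A : Chain a} {B : Chain b} → A ≅ B → B ≅ A
≅-sym {A = A} {B} e = mkIso B A E.from
  (λ x y x≤y → E.cancel (B.trans (B.reflexive (E.to-from x))
                (B.trans x≤y (B.reflexive (B.Eq.sym (E.to-from y))))))
  (λ x y p → B.trans (B.reflexive (B.Eq.sym (E.to-from x)))
              (B.trans (E.mono p) (B.reflexive (E.to-from y))))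
  (λ x → E.to x , E.injective (E.to-from (E.to x)))
  where
  module B = TotalOrder B
  module E = Iso e

≅-trans : {A : Chain a} {B : Chain b} {C : Chain c} → A ≅ B → B ≅ C → A ≅ C
≅-trans {A = A} {B} {C} e f = mkIso A C (F.to ∘ E.to)
  (λ _ _ → F.mono ∘ E.mono) (λ _ _ → E.cancel ∘ F.cancel)
  (λ z → E.from (F.from z)
       , TotalOrder.Eq.trans C (F.cong (E.to-from (F.from z))) (F.to-from z))
  where
  module E = Iso e
  module F = Iso f

-- The relations ρ_n

module _ (A : Chain a) where
  private module A = TotalOrder A

  ~-isEquivalence : ∀ n → IsEquivalence (λ x y → A ⊢ x ~[ n ] y)
  ~-isEquivalence n = ConvexEquivalence.isEquivalence (ρ-fin A n)

  ~-refl : ∀ n {x} → A ⊢ x ~[ n ] x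
  ~-refl n = IsEquivalence.refl (~-isEquivalence n)

  ~-sym : ∀ n {x y} → A ⊢ x ~[ n ] y → A ⊢ y ~[ n ] x
  ~-sym n = IsEquivalence.sym (~-isEquivalence n)

  ~-trans : ∀ n {x y z} → A ⊢ x ~[ n ] y → A ⊢ y ~[ n ] z → A ⊢ x ~[ n ] z
  ~-trans n = IsEquivalence.trans (~-isEquivalence n)

  ~-reflexive : ∀ n {x y} → A ⊢ x ≈ y → A ⊢ x ~[ n ] y
  ~-reflexive n = ConvexEquivalence.reflexive (ρ-fin A n)

  ~-convex : ∀ n {x y z} → A ⊢ x ≤ y → A ⊢ y ≤ z → A ⊢ x ~[ n ] z → A ⊢ x ~[ n ] y
  ~-convex n = ConvexEquivalence.convex (ρ-fin A n)

  ~-suc : ∀ n {x y} → A ⊢ x ~[ n ] y → A ⊢ x ~[ suc n ] y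
  ~-suc n = finiteInterval-refl (A /ρ n)

  ~-raise : ∀ {m n x y} → m ≤′ n → A ⊢ x ~[ m ] y → A ⊢ x ~[ n ] y
  ~-raise (≤′-reflexive refl) p = p
  ~-raise (≤′-step {n} m≤n)   p = ~-suc n (~-raise m≤n p)

  ≲∧≁⇒≤ : ∀ n {x y} → A /ρ n ⊢ x ≤ y → ¬ (A ⊢ x ~[ n ] y) → A ⊢ x ≤ y
  ≲∧≁⇒≤ n (inj₁ x≤y) x≁y = x≤y
  ≲∧≁⇒≤ n (inj₂ x~y) x≁y = contradiction x~y x≁y

-- Convex embeddings

-- Order embeddings with convex image, such as isomorphisms and the inclusions of
-- components, final segments and summands.
record Embedding (A : Chain a) (B : Chain b) : Set (a ⊔ b) where
  private
    module A = TotalOrder A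
    module B = TotalOrder B
  field
    to     : ∣ A ∣ → ∣ B ∣
    mono   : ∀ {x y} → A ⊢ x ≤ y → B ⊢ to x ≤ to y
    cancel : ∀ {x y} → B ⊢ to x ≤ to y → A ⊢ x ≤ y
    convex : ∀ {x z} y → B ⊢ to x ≤ y → B ⊢ y ≤ to z → ∃[ w ] B ⊢ to w ≈ y

  to-cong : ∀ {x y} → A ⊢ x ≈ y → B ⊢ to x ≈ to y
  to-cong p = B.antisym (mono (A.reflexive p)) (mono (A.reflexive (A.Eq.sym p)))

  injective : ∀ {x y} → B ⊢ to x ≈ to y → A ⊢ x ≈ y
  injective p = A.antisym (cancel (B.reflexive p)) (cancel (B.reflexive (B.Eq.sym p)))

embedding : {A : Chain a} {B : Chain b} → A ≅ B → Embedding A B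
embedding e = record
  { to     = Iso.to e
  ; mono   = Iso.mono e
  ; cancel = Iso.cancel e
  ; convex = λ y _ _ → Iso.from e y , Iso.to-from e y
  }

_∘ₑ_ : {A : Chain a} {B : Chain b} {C : Chain c} →
       Embedding B C → Embedding A B → Embedding A C
_∘ₑ_ {C = C} g f = record
  { to     = G.to ∘ F.to
  ; mono   = G.mono ∘ F.mono
  ; cancel = F.cancel ∘ G.cancel
  ; convex = λ y p q →
      let (v , v≈y) = G.convex y p q
          (w , w≈v) = F.convex v (G.cancel (C.trans p (C.reflexive (C.Eq.sym v≈y))))
                                 (G.cancel (C.trans (C.reflexive v≈y) q))
      in w , C.Eq.trans (G.to-cong w≈v) v≈y
  }
  where
  module C = TotalOrder C
  module F = Embedding f
  module G = Embedding g

module _ {A : Chain a} where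
  private module A = TotalOrder A

  inclusion : (P : ∣ A ∣ → Set a) →
              (∀ {x y z} → P x → P z → A ⊢ x ≤ y → A ⊢ y ≤ z → P y) →
              Embedding (subchain A P) A
  inclusion P P-convex = record
    { to     = proj₁
    ; mono   = id
    ; cancel = id
    ; convex = λ { {_ , p} {_ , q} y x≤y y≤z → (y , P-convex p q x≤y y≤z) , A.Eq.refl }
    }

  component-inclusion : ∀ n x → Embedding (component A n x) A
  component-inclusion n x = inclusion _ λ p q y≤z z≤w →
    ~-trans A n p (~-convex A n y≤z z≤w (~-trans A n (~-sym A n p) q))

  from-inclusion : ∀ x → Embedding (A from x) A
  from-inclusion x = inclusion _ λ p _ y≤z _ → A.trans p y≤z

-- A list of representatives, one for each w in ws that is related to anything.
pull : ExcludedMiddle (a ⊔ b) → {X : Set a} {W : Set b} (R : X → W → Set b) (ws : List W) →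
       ∃[ xs ] (∀ x → Any (R x) ws → Any (λ y → ∃[ w ] R x w × R y w) xs)
pull em R [] = [] , λ _ ()
pull em R (w ∷ ws) with em {∃[ y ] R y w} | pull em R ws
... | yes (y , Ryw) | xs , h = y ∷ xs , λ where
  x (here Rxw) → here (w , Rxw , Ryw)
  x (there p)  → there (h x p)
... | no ¬Ryw | xs , h = xs , λ where
  x (here Rxw) → contradiction (x , Rxw) ¬Ryw
  x (there p)  → h x p

module _ {A : Chain a} {B : Chain b} (f : Embedding A B) where
  private
    module A = TotalOrder A
    module B = TotalOrder B
    module F = Embedding f

  -- Points w between f u and f v may lie outside the image, but only if they
  -- are equivalent to f u or f v.
  preserve : ∀ n {x y} → A ⊢ x ~[ n ] y → B ⊢ F.to x ~[ n ] F.to y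
  preserve zero x≈y = F.to-cong x≈y
  preserve (suc n) {x} {y} (zs , covers) = map F.to zs , λ where
      w (inj₁ (p , q)) → between p q end end′ (λ v r s → covers v (inj₁ (r , s)))
      w (inj₂ (p , q)) → between p q end′ end (λ v r s → covers v (inj₂ (r , s)))
    where
    push : ∀ {w v} → B ⊢ F.to v ~[ n ] w → Any (λ z → A ⊢ v ~[ n ] z) zs →
           Any (λ z → B ⊢ w ~[ n ] z) (map F.to zs)
    push p = map⁺ ∘ Any.map (λ q → ~-trans B n (~-sym B n p) (preserve n q))

    end : Any (λ z → A ⊢ x ~[ n ] z) zs
    end with A.total x y
    ... | inj₁ x≤y = covers x (inj₁ (inj₁ A.refl , inj₁ x≤y))
    ... | inj₂ y≤x = covers x (inj₂ (inj₁ y≤x , inj₁ A.refl))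

    end′ : Any (λ z → A ⊢ y ~[ n ] z) zs
    end′ with A.total x y
    ... | inj₁ x≤y = covers y (inj₁ (inj₁ x≤y , inj₁ A.refl))
    ... | inj₂ y≤x = covers y (inj₂ (inj₁ A.refl , inj₁ y≤x))

    between : ∀ {u v w} → B /ρ n ⊢ F.to u ≤ w → B /ρ n ⊢ w ≤ F.to v →
              Any (λ z → A ⊢ u ~[ n ] z) zs → Any (λ z → A ⊢ v ~[ n ] z) zs →
              (∀ t → A /ρ n ⊢ u ≤ t → A /ρ n ⊢ t ≤ v → Any (λ z → A ⊢ t ~[ n ] z) zs) →
              Any (λ z → B ⊢ w ~[ n ] z) (map F.to zs)
    between (inj₂ u~w) _ u∈zs _ _ = push u~w u∈zs
    between _ (inj₂ w~v) _ v∈zs _ = push (~-sym B n w~v) v∈zs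
    between {w = w} (inj₁ u≤w) (inj₁ w≤v) _ _ h =
      let (t , t≈w) = F.convex w u≤w w≤v in
      push (~-reflexive B n t≈w)
        (h t (inj₁ (F.cancel (B.trans u≤w (B.reflexive (B.Eq.sym t≈w)))))
             (inj₁ (F.cancel (B.trans (B.reflexive t≈w) w≤v))))

  mono/ : ∀ n {x y} → A /ρ n ⊢ x ≤ y → B /ρ n ⊢ F.to x ≤ F.to y
  mono/ n (inj₁ p) = inj₁ (F.mono p)
  mono/ n (inj₂ p) = inj₂ (preserve n p)

  -- The converse of preserve.  A point of the list covering the interval in
  -- the larger chain need not come from the smaller one; excluded middle
  -- selects a preimage class whenever there is one.
  reflect : ExcludedMiddle (a ⊔ b) → ∀ n {x y} → B ⊢ F.to x ~[ n ] F.to y → A ⊢ x ~[ n ] y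
  reflect em zero p = F.injective p
  reflect em (suc n) {x} {y} (ws , covers) = xs , λ where
      z (inj₁ (p , q)) → back z (covers (F.to z) (inj₁ (mono/ n p , mono/ n q)))
      z (inj₂ (p , q)) → back z (covers (F.to z) (inj₂ (mono/ n p , mono/ n q)))
    where
    pulled = pull em (λ z w → B ⊢ F.to z ~[ n ] w) ws
    xs = proj₁ pulled

    back : ∀ z → Any (λ w → B ⊢ F.to z ~[ n ] w) ws → Any (λ z′ → A ⊢ z ~[ n ] z′) xs
    back z p = Any.map (λ (w , z~w , z′~w) → reflect em n (~-trans B n z~w (~-sym B n z′~w)))
                       (proj₂ pulled z p)

  cancel/ : ExcludedMiddle (a ⊔ b) → ∀ n {x y} → B /ρ n ⊢ F.to x ≤ F.to y → A /ρ n ⊢ x ≤ y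
  cancel/ em n (inj₁ p) = inj₁ (F.cancel p)
  cancel/ em n (inj₂ p) = inj₂ (reflect em n p)

  -- A component that lies in the image is the image of a component.
  component-≅ : ExcludedMiddle (a ⊔ b) → ∀ n x →
                (∀ y → B ⊢ F.to x ~[ n ] y → ∃[ w ] B ⊢ F.to w ≈ y) →
                component A n x ≅ component B n (F.to x)
  component-≅ em n x image = mkIso (component A n x) (component B n (F.to x))
    (λ (y , p) → F.to y , preserve n p)
    (λ _ _ → F.mono) (λ _ _ → F.cancel)
    (λ (y , p) → let (w , w≈y) = image y p in
      (w , reflect em n (~-trans B n p (~-sym B n (~-reflexive B n w≈y)))) , w≈y)

module _ {A : Chain a} {B : Chain b} (em : ExcludedMiddle (a ⊔ b)) (e : A ≅ B) where

  quotient-iso : ∀ n → A /ρ n ≅ B /ρ n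
  quotient-iso n = mkIso (A /ρ n) (B /ρ n) (Iso.to e)
    (λ _ _ → mono/ (embedding e) n) (λ _ _ → cancel/ (embedding e) em n)
    (λ y → Iso.from e y , ~-reflexive B n (Iso.to-from e y))

  component-iso : ∀ n x → component A n x ≅ component B n (Iso.to e x)
  component-iso n x = component-≅ (embedding e) em n x
    λ y _ → Iso.from e y , Iso.to-from e y

module _ (A : Chain a) where
  private module A = TotalOrder A

  component-cong : ∀ n {x y} → A ⊢ x ~[ n ] y → component A n x ≅ component A n y
  component-cong n {x} {y} x~y = mkIso (component A n x) (component A n y)
    (λ (z , p) → z , ~-trans A n (~-sym A n x~y) p) (λ _ _ → id) (λ _ _ → id)
    (λ (z , p) → (z , ~-trans A n x~y p) , A.Eq.refl)

  -- The n-components of [x]_{n+1} are n-components of A.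
  component-component : ExcludedMiddle a → ∀ n x y →
                        component (component A (suc n) x) n y ≅ component A n (proj₁ y)
  component-component em n x y = component-≅ (component-inclusion (suc n) x) em n y
    λ z p → (z , ~-trans A (suc n) (proj₂ y) (~-suc A n p)) , A.Eq.refl

  -- If all of A is a single n-component then [x]_n is A.
  component-whole : ∀ n x → (∀ y → A ⊢ x ~[ n ] y) → component A n x ≅ A
  component-whole n x h = mkIso (component A n x) A proj₁ (λ _ _ → id) (λ _ _ → id)
    λ y → (y , h y) , A.Eq.refl

-- Locally finite chains

_ᵒᵖ : Chain a → Chain a
_ᵒᵖ = Flip.totalOrder

-- Endless chains have no greatest element.
LocallyFinite Endless : Chain a → Set a
LocallyFinite Q = ∀ x y → FiniteInterval Q x y
Endless Q       = ∀ x → ∃[ y ] Q ⊢ x ≤ y × ¬ (Q ⊢ x ≈ y)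

-- y is the immediate successor of x.
Covers : (Q : Chain a) → ∣ Q ∣ → ∣ Q ∣ → Set a
Covers Q x y = Q ⊢ x ≤ y × ¬ (Q ⊢ x ≈ y) × (∀ z → Q ⊢ x ≤ z → ¬ (Q ⊢ x ≈ z) → Q ⊢ y ≤ z)

module _ (Q : Chain a) where
  private module Q = TotalOrder Q

  -- A property P of points of Q that has finitely many witnesses above one of
  -- them has a greatest witness.
  greatest : ExcludedMiddle a → (P : ∣ Q ∣ → Set a) → (∀ {x y} → Q ⊢ x ≈ y → P x → P y) →
             ∀ zs u → P u → (∀ y → P y → Q ⊢ u ≤ y → Any (λ z → Q ⊢ y ≈ z) zs) →
             ∃[ m ] P m × (∀ y → P y → Q ⊢ y ≤ m)
  greatest em P P-resp zs u Pu covers with climb zs u Pu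
    where
    climb : ∀ zs m → P m →
            ∃[ m′ ] P m′ × Q ⊢ m ≤ m′ × (∀ y → P y → Any (λ z → Q ⊢ y ≈ z) zs → Q ⊢ y ≤ m′)
    climb [] m Pm = m , Pm , Q.refl , λ _ _ ()
    climb (z ∷ zs) m Pm with em {P z × Q ⊢ m ≤ z}
    ... | yes (Pz , m≤z) =
      let (m′ , Pm′ , z≤m′ , h) = climb zs z Pz in
      m′ , Pm′ , Q.trans m≤z z≤m′ , λ where
        y Py (here y≈z) → Q.trans (Q.reflexive y≈z) z≤m′
        y Py (there p)  → h y Py p
    ... | no ¬p =
      let (m′ , Pm′ , m≤m′ , h) = climb zs m Pm in
      m′ , Pm′ , m≤m′ , λ where
        y Py (here y≈z) → Q.trans (below y≈z Py (Q.total m z)) m≤m′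
        y Py (there p)  → h y Py p
      where
      below : ∀ {y} → Q ⊢ y ≈ z → P y → Q ⊢ m ≤ z ⊎ Q ⊢ z ≤ m → Q ⊢ y ≤ m
      below y≈z Py (inj₁ m≤z) = contradiction (P-resp y≈z Py , m≤z) ¬p
      below y≈z Py (inj₂ z≤m) = Q.trans (Q.reflexive y≈z) z≤m
  ... | m , Pm , u≤m , h = m , Pm , above
    where
    above : ∀ y → P y → Q ⊢ y ≤ m
    above y Py with Q.total u y
    ... | inj₁ u≤y = h y Py (covers y Py u≤y)
    ... | inj₂ y≤u = Q.trans y≤u u≤m

  covers-unique : ∀ {x x′ y y′} → Q ⊢ x ≈ x′ → Covers Q x y → Covers Q x′ y′ → Q ⊢ y ≈ y′
  covers-unique x≈x′ (x≤y , x≉y , h) (x′≤y′ , x′≉y′ , h′) = Q.antisym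
    (h _ (Q.trans (Q.reflexive x≈x′) x′≤y′) (x′≉y′ ∘ Q.Eq.trans (Q.Eq.sym x≈x′)))
    (h′ _ (Q.trans (Q.reflexive (Q.Eq.sym x≈x′)) x≤y) (x≉y ∘ Q.Eq.trans x≈x′))

  neighbours⇒finite : ∀ {x y} → Q ⊢ x ≤ y →
                      (∀ z → Q ⊢ x ≤ z → Q ⊢ z ≤ y → Q ⊢ z ≈ x ⊎ Q ⊢ z ≈ y) →
                      FiniteInterval Q x y
  neighbours⇒finite {x} {y} x≤y h = x ∷ y ∷ [] , λ where
      z (inj₁ (x≤z , z≤y)) → split (h z x≤z z≤y)
      z (inj₂ (y≤z , z≤x)) → split (inj₂ (Q.antisym (Q.trans z≤x x≤y) y≤z))
    where
    split : ∀ {z} → Q ⊢ z ≈ x ⊎ Q ⊢ z ≈ y → Any (λ w → Q ⊢ z ≈ w) (x ∷ y ∷ [])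
    split (inj₁ z≈x) = here z≈x
    split (inj₂ z≈y) = there (here z≈y)

module _ (em : ExcludedMiddle a) (Q : Chain a) where
  private module Q = TotalOrder Q

  successor : ∀ {x y} → Q ⊢ x ≤ y → ¬ (Q ⊢ x ≈ y) → FiniteInterval Q x y → ∃[ z ] Covers Q x z
  successor {x} {y} x≤y x≉y (zs , covers) =
    let (m , (x≤m , x≉m) , h) = greatest (Q ᵒᵖ) em P P-resp zs y (x≤y , x≉y)
                                  (λ z (x≤z , _) z≤y → covers z (inj₁ (x≤z , z≤y)))
    in m , x≤m , x≉m , λ z x≤z x≉z → h z (x≤z , x≉z)
    where
    P : ∣ Q ∣ → Set a
    P z = Q ⊢ x ≤ z × ¬ (Q ⊢ x ≈ z)

    P-resp : ∀ {u v} → Q ⊢ u ≈ v → P u → P v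
    P-resp u≈v (x≤u , x≉u) =
      Q.trans x≤u (Q.reflexive u≈v) , λ x≈v → x≉u (Q.Eq.trans x≈v (Q.Eq.sym u≈v))

  -- The points x₀ = seq 0 < seq 1 < …, each the immediate successor of the one
  -- before; they exhaust the points above x₀.
  module Successors (finite : LocallyFinite Q) (endless : Endless Q) (x₀ : ∣ Q ∣) where

    next : ∀ x → ∃[ y ] Covers Q x y
    next x = let (y , x≤y , x≉y) = endless x in successor x≤y x≉y (finite x y)

    seq : ℕ → ∣ Q ∣
    seq zero    = x₀
    seq (suc i) = proj₁ (next (seq i))

    seq-step : ∀ i → Covers Q (seq i) (seq (suc i))
    seq-step i = proj₂ (next (seq i))

    seq-mono′ : ∀ {i j} → i ≤′ j → Q ⊢ seq i ≤ seq j
    seq-mono′ (≤′-reflexive refl) = Q.refl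
    seq-mono′ (≤′-step {j} p)     = Q.trans (seq-mono′ p) (proj₁ (seq-step j))

    seq-mono : ∀ {i j} → i ℕ.≤ j → Q ⊢ seq i ≤ seq j
    seq-mono = seq-mono′ ∘ ℕ.≤⇒≤′

    seq-strict : ∀ {i j} → i ℕ.< j → ¬ (Q ⊢ seq i ≈ seq j)
    seq-strict {i} i<j p = proj₁ (proj₂ (seq-step i))
      (Q.antisym (proj₁ (seq-step i))
                 (Q.trans (seq-mono i<j) (Q.reflexive (Q.Eq.sym p))))

    seq-injective : ∀ {i j} → Q ⊢ seq i ≈ seq j → i ≡ j
    seq-injective {i} {j} p with ℕ.<-cmp i j
    ... | tri< i<j _ _ = contradiction p (seq-strict i<j)
    ... | tri≈ _ i≡j _ = i≡j
    ... | tri> _ _ j<i = contradiction (Q.Eq.sym p) (seq-strict j<i)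

    seq-onto : ∀ y → Q ⊢ x₀ ≤ y → ∃[ i ] Q ⊢ seq i ≈ y
    seq-onto y x₀≤y with greatest Q em P P-resp (proj₁ (finite x₀ y)) x₀ ((0 , Q.Eq.refl) , x₀≤y)
                           (λ z (_ , z≤y) x₀≤z → proj₂ (finite x₀ y) z (inj₁ (x₀≤z , z≤y)))
      where
      P : ∣ Q ∣ → Set a
      P z = (∃[ i ] Q ⊢ seq i ≈ z) × Q ⊢ z ≤ y

      P-resp : ∀ {u v} → Q ⊢ u ≈ v → P u → P v
      P-resp u≈v ((i , p) , u≤y) =
        (i , Q.Eq.trans p u≈v) , Q.trans (Q.reflexive (Q.Eq.sym u≈v)) u≤y
    ... | m , ((i , i≈m) , m≤y) , h with em {Q ⊢ m ≈ y}
    ...   | yes m≈y = i , Q.Eq.trans i≈m m≈y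
    ...   | no  m≉y =
      let (p , i≉ , least) = seq-step i
          next≤y = least y (Q.trans (Q.reflexive i≈m) m≤y) (m≉y ∘ Q.Eq.trans (Q.Eq.sym i≈m))
          next≤m = h (seq (suc i)) ((suc i , Q.Eq.refl) , next≤y)
      in contradiction (Q.antisym p (Q.trans next≤m (Q.reflexive (Q.Eq.sym i≈m)))) i≉

  ≅ℕ-chain : LocallyFinite Q → Endless Q → (x₀ : ∣ Q ∣) → (∀ y → Q ⊢ x₀ ≤ y) → Q ≅ ℕ-chain
  ≅ℕ-chain finite endless x₀ least = ≅-sym (mkIso-injective ℕ-chain Q seq
    (λ _ _ → seq-mono) (λ _ _ _ → seq-injective) (λ y → seq-onto y (least y)))
    where open Successors finite endless x₀

locallyFinite-ᵒᵖ : {Q : Chain a} → LocallyFinite Q → LocallyFinite (Q ᵒᵖ)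
locallyFinite-ᵒᵖ finite x y = let (zs , covers) = finite x y in zs , λ where
  z (inj₁ (z≤x , y≤z)) → covers z (inj₂ (y≤z , z≤x))
  z (inj₂ (z≤y , x≤z)) → covers z (inj₁ (x≤z , z≤y))

module _ (em : ExcludedMiddle a) (Q : Chain a) where
  private module Q = TotalOrder Q

  ≅ℤ-chain : LocallyFinite Q → Endless Q → Endless (Q ᵒᵖ) → ∣ Q ∣ → Q ≅ ℤ-chain
  ≅ℤ-chain finite endless endless′ x₀ =
    ≅-sym (mkIso-injective ℤ-chain Q point mono injective onto)
    where
    module Up   = Successors em Q finite endless x₀
    module Down = Successors em (Q ᵒᵖ) (locallyFinite-ᵒᵖ {Q = Q} finite) endless′ x₀

    point : ℤ → ∣ Q ∣
    point (+ i)    = Up.seq i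
    point -[1+ i ] = Down.seq (suc i)

    mono : ∀ i j → i ℤ.≤ j → Q ⊢ point i ≤ point j
    mono _ _ (+≤+ i≤j) = Up.seq-mono i≤j
    mono _ _ (-≤- j≤i) = Down.seq-mono (ℕ.s≤s j≤i)
    mono -[1+ i ] (+ j) -≤+ = Q.trans (Down.seq-mono {0} {suc i} z≤n) (Up.seq-mono {0} {j} z≤n)

    injective : ∀ i j → i ℤ.≤ j → Q ⊢ point i ≈ point j → i ≡ j
    injective _ _ (+≤+ _) p = cong +_ (Up.seq-injective p)
    injective _ _ (-≤- _) p = cong -[1+_] (ℕ.suc-injective (Down.seq-injective p))
    injective -[1+ i ] (+ j) -≤+ p with () ← Down.seq-injective {suc i} {0}
      (Q.antisym (Down.seq-mono {0} {suc i} z≤n)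
                 (Q.trans (Up.seq-mono {0} {j} z≤n) (Q.reflexive (Q.Eq.sym p))))

    onto : ∀ y → ∃[ i ] Q ⊢ point i ≈ y
    onto y with Q.total x₀ y
    ... | inj₁ x₀≤y = let (i , p) = Up.seq-onto y x₀≤y in + i , p
    ... | inj₂ y≤x₀ with Down.seq-onto y y≤x₀
    ...   | zero  , p = + 0 , p
    ...   | suc i , p = -[1+ i ] , p

-- The chains ℕ and ℤ

endless-ℕ : Endless ℕ-chain
endless-ℕ i = suc i , ℕ.n≤1+n i , ℕ.1+n≢n ∘ sym

endless-ℤ : Endless ℤ-chain
endless-ℤ i = ℤ.suc i , ℤ.i≤suc[i] i , ℤ.i≢suc[i]

finite-ℕ-suc : ∀ i → FiniteInterval ℕ-chain i (suc i)
finite-ℕ-suc i = neighbours⇒finite ℕ-chain (ℕ.n≤1+n i) λ z p q →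
  Sum.map sym (ℕ.≤-antisym q) (Sum.swap (ℕ.m≤n⇒m<n∨m≡n p))

finite-ℤ-suc : ∀ i → FiniteInterval ℤ-chain i (ℤ.suc i)
finite-ℤ-suc i = neighbours⇒finite ℤ-chain (ℤ.i≤suc[i] i) split
  where
  split : ∀ z → i ℤ.≤ z → z ℤ.≤ ℤ.suc i → z ≡ i ⊎ z ≡ ℤ.suc i
  split z p q with z ℤ.≟ i
  ... | yes z≡i = inj₁ z≡i
  ... | no  z≢i = inj₂ (ℤ.≤-antisym q (ℤ.i<j⇒suc[i]≤j (ℤ.≤∧≢⇒< p (z≢i ∘ sym))))

finite-from : (Q : Chain a) (x₀ : ∣ Q ∣) → (∀ x → FiniteInterval Q x₀ x) → LocallyFinite Q
finite-from Q x₀ h x y = finiteInterval-trans Q (finiteInterval-sym Q (h x)) (h y)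

finite-ℕ : LocallyFinite ℕ-chain
finite-ℕ = finite-from ℕ-chain 0 from-0
  where
  from-0 : ∀ i → FiniteInterval ℕ-chain 0 i
  from-0 zero    = finiteInterval-refl ℕ-chain refl
  from-0 (suc i) = finiteInterval-trans ℕ-chain (from-0 i) (finite-ℕ-suc i)

finite-ℤ : LocallyFinite ℤ-chain
finite-ℤ = finite-from ℤ-chain 0ℤ from-0
  where
  from-0 : ∀ i → FiniteInterval ℤ-chain 0ℤ i
  from-0 (+ zero)       = finiteInterval-refl ℤ-chain refl
  from-0 (+ suc i)      = finiteInterval-trans ℤ-chain (from-0 (+ i)) (finite-ℤ-suc (+ i))
  from-0 -[1+ zero ]    = finiteInterval-sym ℤ-chain (finite-ℤ-suc -[1+ 0 ])
  from-0 -[1+ suc i ]   = finiteInterval-trans ℤ-chain (from-0 -[1+ i ])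
                            (finiteInterval-sym ℤ-chain (finite-ℤ-suc -[1+ suc i ]))

module _ {P : Chain a} {Q : Chain b} (e : P ≅ Q) where
  private
    module P = TotalOrder P
    module Q = TotalOrder Q
    module E = Iso e

  locallyFinite-≅ : LocallyFinite Q → LocallyFinite P
  locallyFinite-≅ finite x y with finite (E.to x) (E.to y)
  ... | zs , covers = map E.from zs , λ where
      z (inj₁ (p , q)) → back (covers (E.to z) (inj₁ (E.mono p , E.mono q)))
      z (inj₂ (p , q)) → back (covers (E.to z) (inj₂ (E.mono p , E.mono q)))
    where
    back : ∀ {z} → Any (λ w → Q ⊢ E.to z ≈ w) zs → Any (λ w → P ⊢ z ≈ w) (map E.from zs)
    back = map⁺ ∘ Any.map (λ p → E.injective (Q.Eq.trans p (Q.Eq.sym (E.to-from _))))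

  endless-≅ : Endless Q → Endless P
  endless-≅ endless x = let (y , p , q) = endless (E.to x) in
      E.from y
    , E.cancel (Q.trans p (Q.reflexive (Q.Eq.sym (E.to-from y))))
    , λ r → q (Q.Eq.trans (E.cong r) (E.to-from y))

-- Immediate successors in Q can be read off from an isomorphism Q ≅ I.
covers-from : {Q : Chain c} {I : Chain d} (e : Q ≅ I) → ∀ {i j y} → Covers I i j →
              I ⊢ Iso.to e y ≈ j → Covers Q (Iso.from e i) y
covers-from {Q = Q} {I} e {i} {j} {y} (i≤j , i≉j , h) y≈j =
    E.cancel (I.trans (I.reflexive (E.to-from i)) (I.trans i≤j (I.reflexive (I.Eq.sym y≈j))))
  , (λ p → i≉j (I.Eq.trans (I.Eq.sym (E.to-from i)) (I.Eq.trans (E.cong p) y≈j)))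
  , λ z p q → E.cancel (I.trans (I.reflexive y≈j) (h (E.to z)
      (I.trans (I.reflexive (I.Eq.sym (E.to-from i))) (E.mono p))
      (λ r → q (E.injective (I.Eq.trans (E.to-from i) r)))))
  where
  module I = TotalOrder I
  module E = Iso e

covers-ℕ : ∀ i → Covers ℕ-chain i (suc i)
covers-ℕ i = ℕ.n≤1+n i , ℕ.1+n≢n ∘ sym , λ _ → ℕ.≤∧≢⇒<

covers-ℤ : ∀ i → Covers ℤ-chain (ℤ.pred i) i
covers-ℤ i = subst (Covers ℤ-chain (ℤ.pred i)) (ℤ.suc-pred i)
  ( ℤ.i≤suc[i] (ℤ.pred i) , ℤ.i≢suc[i]
  , λ _ p q → ℤ.i<j⇒suc[i]≤j (ℤ.≤∧≢⇒< p q))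

-- Gluing isomorphisms of components

module _ (em : ExcludedMiddle c) (n : ℕ) (C : Chain c) (D : Chain d)
         (q : C /ρ n ≅ D /ρ n) where
  private
    module C = TotalOrder C
    module D = TotalOrder D
    module D/ρ = TotalOrder (D /ρ n)
    module Q = Iso q

  -- A map that induces an isomorphism of the quotients and is an isomorphism
  -- within the classes is an isomorphism.
  glue : (f : ∣ C ∣ → ∣ D ∣) →
         (∀ x → D ⊢ f x ~[ n ] Q.to x) →
         (∀ x y → C ⊢ x ~[ n ] y → C ⊢ x ≤ y → D ⊢ f x ≤ f y) →
         (∀ x y → C ⊢ x ~[ n ] y → D ⊢ f x ≤ f y → C ⊢ x ≤ y) →
         (∀ y → ∃[ x ] D ⊢ f x ≈ y) →
         C ≅ D
  glue f f~q mono~ cancel~ onto = mkIso C D f mono cancel onto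
    where
    reflect~ : ∀ x y → D ⊢ f x ~[ n ] f y → C ⊢ x ~[ n ] y
    reflect~ x y p = Q.injective
      (~-trans D n (~-sym D n (f~q x)) (~-trans D n p (f~q y)))

    mono : ∀ x y → C ⊢ x ≤ y → D ⊢ f x ≤ f y
    mono x y x≤y with em {C ⊢ x ~[ n ] y}
    ... | yes x~y = mono~ x y x~y x≤y
    ... | no  x≁y = ≲∧≁⇒≤ D n
      (D/ρ.trans {f x} {Q.to x} {f y} (inj₂ (f~q x))
        (D/ρ.trans {Q.to x} {Q.to y} {f y} (Q.mono (inj₁ x≤y)) (inj₂ (~-sym D n (f~q y)))))
      (x≁y ∘ reflect~ x y)

    cancel : ∀ x y → D ⊢ f x ≤ f y → C ⊢ x ≤ y
    cancel x y fx≤fy with em {C ⊢ x ~[ n ] y}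
    ... | yes x~y = cancel~ x y x~y fx≤fy
    ... | no  x≁y with C.total x y
    ...   | inj₁ x≤y = x≤y
    ...   | inj₂ y≤x = contradiction
      (reflect~ x y (~-reflexive D n (D.antisym fx≤fy (mono y x y≤x)))) x≁y

  -- The isomorphisms φ x and φ y need not agree for x and y in the same class.
  -- The map C / n → I provides a canonical point rep x of each class, and φ is
  -- used at these points only.
  assemble : (I : Chain 0ℓ) → (∀ {i j} → I ⊢ i ≈ j → i ≡ j) → C /ρ n ≅ I →
             (∀ x → component C n x ≅ component D n (Q.to x)) →
             Σ[ f ∈ C ≅ D ] ∀ x → D ⊢ Iso.to f x ~[ n ] Q.to x
  assemble I strict e φ = glue f f~q
      (λ x y x~y → mono-rep (rep≡ x~y) (rep~ x) (rep~ y))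
      (λ x y x~y → cancel-rep (rep≡ x~y) (rep~ x) (rep~ y))
      onto
    , f~q
    where
    module E = Iso e

    rep : ∣ C ∣ → ∣ C ∣
    rep x = E.from (E.to x)

    rep~ : ∀ x → C ⊢ rep x ~[ n ] x
    rep~ x = E.injective (E.to-from (E.to x))

    rep≡ : ∀ {x y} → C ⊢ x ~[ n ] y → rep x ≡ rep y
    rep≡ p = cong E.from (strict (E.cong p))

    move : ∀ r x → C ⊢ r ~[ n ] x → ∣ D ∣
    move r x p = proj₁ (Iso.to (φ r) (x , p))

    f : ∣ C ∣ → ∣ D ∣
    f x = move (rep x) x (rep~ x)

    f~q : ∀ x → D ⊢ f x ~[ n ] Q.to x
    f~q x = ~-trans D n (~-sym D n (proj₂ (Iso.to (φ (rep x)) (x , rep~ x)))) (Q.cong (rep~ x))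

    mono-rep : ∀ {r s x y} → r ≡ s → (p : C ⊢ r ~[ n ] x) (q : C ⊢ s ~[ n ] y) →
               C ⊢ x ≤ y → D ⊢ move r x p ≤ move s y q
    mono-rep {r} refl p q = Iso.mono (φ r)

    cancel-rep : ∀ {r s x y} → r ≡ s → (p : C ⊢ r ~[ n ] x) (q : C ⊢ s ~[ n ] y) →
                 D ⊢ move r x p ≤ move s y q → C ⊢ x ≤ y
    cancel-rep {r} refl p q = Iso.cancel (φ r)

    onto : ∀ y → ∃[ x ] D ⊢ f x ≈ y
    onto y =
      let r       = rep (Q.from y)
          qr~y    = ~-trans D n (Q.cong (rep~ (Q.from y))) (Q.to-from y)
          (x , p) = Iso.from (φ r) (y , qr~y)
          r≡      = rep≡ (~-trans C n (~-sym C n p) (rep~ (Q.from y)))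
          same    = D.antisym (mono-rep r≡ (rep~ x) p C.refl)
                              (mono-rep (sym r≡) p (rep~ x) C.refl)
      in x , D.Eq.trans same (Iso.to-from (φ r) (y , qr~y))

-- Shapes

-- D consists of n-components isomorphic to B, arranged in order type ℤ.
record ℤ-Shape (n : ℕ) (D : Chain d) (B : Chain b) : Set (d ⊔ b) where
  field
    quotient : D /ρ n ≅ ℤ-chain
    parts    : ∀ x → component D n x ≅ B

-- D consists of n-components arranged in order type ℕ; the initial one is
-- isomorphic to B′ and the others to B.
record ℕ-Shape (n : ℕ) (D : Chain d) (B′ : Chain b′) (B : Chain b) : Set (d ⊔ b ⊔ b′) where
  field
    quotient : D /ρ n ≅ ℕ-chain

  level : ∣ D ∣ → ℕ
  level = Iso.to quotient

  field
    initial : ∀ x → level x ≡ 0 → component D n x ≅ B′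
    later   : ∀ x → level x ≢ 0 → component D n x ≅ B

module _ {C : Chain c} {D : Chain d} (em : ExcludedMiddle (c ⊔ d)) (e : C ≅ D) where

  ℤ-Shape-≅ : ∀ {n} {B : Chain b} → ℤ-Shape n D B → ℤ-Shape n C B
  ℤ-Shape-≅ {n = n} S = record
    { quotient = ≅-trans (quotient-iso em e n) S.quotient
    ; parts    = λ x → ≅-trans (component-iso em e n x) (S.parts (Iso.to e x))
    }
    where module S = ℤ-Shape S

  ℕ-Shape-≅ : ∀ {n} {B′ : Chain b′} {B : Chain b} → ℕ-Shape n D B′ B → ℕ-Shape n C B′ B
  ℕ-Shape-≅ {n = n} S = record
    { quotient = ≅-trans (quotient-iso em e n) S.quotient
    ; initial  = λ x p → ≅-trans (component-iso em e n x) (S.initial (Iso.to e x) p)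
    ; later    = λ x p → ≅-trans (component-iso em e n x) (S.later (Iso.to e x) p)
    }
    where module S = ℕ-Shape S

-- ℤ has no least element.
ℕ≇ℤ : {Q : Chain c} → Q ≅ ℕ-chain → Q ≅ ℤ-chain → ∀ {ℓ} {X : Set ℓ} → X
ℕ≇ℤ {Q = Q} e f = contradiction
    (ℤ.≤-trans (F.mono (E.cancel (ℕ.≤-trans (ℕ.≤-reflexive (E.to-from 0)) z≤n)))
               (ℤ.≤-reflexive (F.to-from below)))
    (ℤ.<⇒≱ (ℤ.i≤pred[j]⇒i<j ℤ.≤-refl))
  where
  module E = Iso e
  module F = Iso f
  below = ℤ.pred (F.to (E.from 0))

-- Every isomorphism onto ℕ maps the least element to 0.
level-zero : {Q : Chain c} (e f : Q ≅ ℕ-chain) → ∀ {x} → Iso.to e x ≡ 0 → Iso.to f x ≡ 0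
level-zero e f {x} p = ℕ.n≤0⇒n≡0 (ℕ.≤-trans
    (F.mono (E.cancel (ℕ.≤-trans (ℕ.≤-reflexive p) z≤n)))
    (ℕ.≤-reflexive (F.to-from 0)))
  where
  module E = Iso e
  module F = Iso f

module _ {D : Chain d} {n : ℕ} where

  ℤ-Shape-parts : {B : Chain b} {C : Chain c} → ℤ-Shape n D B → ℤ-Shape n D C → B ≅ C
  ℤ-Shape-parts S T = ≅-trans (≅-sym (ℤ-Shape.parts S x)) (ℤ-Shape.parts T x)
    where x = Iso.from (ℤ-Shape.quotient S) 0ℤ

  module _ {B′ : Chain b′} {B : Chain b} {C′ : Chain c} {C : Chain a}
           (S : ℕ-Shape n D B′ B) (T : ℕ-Shape n D C′ C) where
    private
      module S = ℕ-Shape S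
      module T = ℕ-Shape T

    ℕ-Shape-initial : B′ ≅ C′
    ℕ-Shape-initial = ≅-trans (≅-sym (S.initial x p))
                              (T.initial x (level-zero S.quotient T.quotient p))
      where
      x = Iso.from S.quotient 0
      p = Iso.to-from S.quotient 0

    ℕ-Shape-later : B ≅ C
    ℕ-Shape-later = ≅-trans (≅-sym (S.later x p)) (T.later x (p ∘ level-zero T.quotient S.quotient))
      where
      x = Iso.from S.quotient 1
      p : S.level x ≢ 0
      p eq with () ← trans (sym (Iso.to-from S.quotient 1)) eq

shift : ∀ k → ℤ-chain ≅ ℤ-chain
shift k = mkIso-injective ℤ-chain ℤ-chain (ℤ._+ k)
  (λ _ _ → ℤ.+-monoˡ-≤ k) (λ i j _ → ∙-cancelʳ k i j)
  (λ i → i ℤ.- k , //-rightDividesˡ k i)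
  where open Algebra.Properties.AbelianGroup ℤ.+-0-abelianGroup using (∙-cancelʳ; //-rightDividesˡ)

module _ (em : ExcludedMiddle c) {C : Chain c} {D : Chain d} {n : ℕ} where
  private
    module C = TotalOrder C
    module D = TotalOrder D

  ℕ-Shape-unique : {B′ : Chain b′} {B : Chain b} → ℕ-Shape n C B′ B → ℕ-Shape n D B′ B → C ≅ D
  ℕ-Shape-unique S T = proj₁ (assemble em n C D q ℕ-chain id S.quotient parts)
    where
    module S = ℕ-Shape S
    module T = ℕ-Shape T
    q = ≅-trans S.quotient (≅-sym T.quotient)

    level-q : ∀ x → T.level (Iso.to q x) ≡ S.level x
    level-q x = Iso.to-from T.quotient (S.level x)

    parts : ∀ x → component C n x ≅ component D n (Iso.to q x)
    parts x with S.level x ℕ.≟ 0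
    ... | yes p = ≅-trans (S.initial x p) (≅-sym (T.initial _ (trans (level-q x) p)))
    ... | no ¬p = ≅-trans (S.later x ¬p) (≅-sym (T.later _ (¬p ∘ trans (sym (level-q x)))))

  -- The isomorphism can be made to match any two n-components.
  ℤ-Shape-unique : {B : Chain b} → ℤ-Shape n C B → ℤ-Shape n D B → ∀ x y →
                   Σ[ f ∈ C ≅ D ] D ⊢ Iso.to f x ~[ n ] y
  ℤ-Shape-unique S T x y = f , ~-trans D n (f~q x) (Iso.injective T.quotient aligned)
    where
    module S = ℤ-Shape S
    module T = ℤ-Shape T
    s = Iso.to S.quotient x
    t = Iso.to T.quotient y
    -- The shift takes the position s of [x]_n to the position t of [y]_n.
    q = ≅-trans S.quotient (≅-trans (shift (t ℤ.- s)) (≅-sym T.quotient))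

    assembled = assemble em n C D q ℤ-chain id S.quotient
                  (λ z → ≅-trans (S.parts z) (≅-sym (T.parts (Iso.to q z))))
    f   = proj₁ assembled
    f~q = proj₂ assembled

    aligned : Iso.to T.quotient (Iso.to q x) ≡ t
    aligned = trans (Iso.to-from T.quotient (s ℤ.+ (t ℤ.- s)))
      (trans (ℤ.+-comm s (t ℤ.- s)) (Iso.to-from (shift s) t))

-- Immediate successors in quotients

module _ {A : Chain a} {B : Chain b} (em : ExcludedMiddle (a ⊔ b)) (f : Embedding A B) (n : ℕ) where
  private
    module A = TotalOrder A
    module B = TotalOrder B
    module B/ρ = TotalOrder (B /ρ n)
    module F = Embedding f

  covers-preserve : ∀ {x y} → Covers (A /ρ n) x y → Covers (B /ρ n) (F.to x) (F.to y)
  covers-preserve {x} {y} (x≤y , x≁y , h) = mono/ f n x≤y , x≁y ∘ reflect f em n , h′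
    where
    h′ : ∀ z → B /ρ n ⊢ F.to x ≤ z → ¬ (B ⊢ F.to x ~[ n ] z) → B /ρ n ⊢ F.to y ≤ z
    h′ z x≲z x≁z with B.total z (F.to y)
    ... | inj₂ y≤z = inj₁ y≤z
    ... | inj₁ z≤y =
      let (w , w≈z) = F.convex z (≲∧≁⇒≤ B n x≲z x≁z) z≤y
          w~z = ~-reflexive B n w≈z
      in B/ρ.trans {F.to y} {F.to w} {z} (mono/ f n (h w
           (cancel/ f em n (B/ρ.trans {F.to x} {z} {F.to w} x≲z (inj₂ (~-sym B n w~z))))
           (λ p → x≁z (~-trans B n (preserve f n p) w~z))))
           (inj₂ w~z)

  covers-reflect : ∀ {x y} → Covers (B /ρ n) (F.to x) (F.to y) → Covers (A /ρ n) x y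
  covers-reflect (x≤y , x≁y , h) =
      cancel/ f em n x≤y , x≁y ∘ preserve f n
    , λ z x≲z x≁z → cancel/ f em n (h (F.to z) (mono/ f n x≲z) (x≁z ∘ reflect f em n))

  -- For an embedding onto a final segment, components that have a
  -- predecessor are not cut off.
  component-covered : (∀ x y → B ⊢ F.to x ≤ y → ∃[ w ] B ⊢ F.to w ≈ y) →
                      ∀ {x y} → Covers (A /ρ n) x y → component A n y ≅ component B n (F.to y)
  component-covered final {x} {y} covers = component-≅ f em n y image
    where
    covers′ = covers-preserve covers

    image : ∀ z → B ⊢ F.to y ~[ n ] z → ∃[ w ] B ⊢ F.to w ≈ z
    image z y~z with B.total (F.to x) z
    ... | inj₁ x≤z = final x z x≤z
    ... | inj₂ z≤x = contradiction
      (~-trans B n (~-sym B n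
        (~-convex B n z≤x (≲∧≁⇒≤ B n (proj₁ covers′) (proj₁ (proj₂ covers′))) (~-sym B n y~z)))
        (~-sym B n y~z))
      (proj₁ (proj₂ covers′))

-- Layered chains

-- B has no last m-component, where n = m + 1; there is no condition for n = 0.
Unbounded : ℕ → Chain 0ℓ → Set
Unbounded zero    B = ⊤
Unbounded (suc m) B = Endless (B /ρ m)

-- The properties of chains B_i which ensure that the n-components of their
-- ordered sum are exactly the summands: a summand is contained in a single
-- n-component, and it does not merge with the summands after it.
record Block (n : ℕ) (B : Chain 0ℓ) : Set where
  field
    whole     : ∀ x y → B ⊢ x ~[ n ] y
    unbounded : Unbounded n B
    point     : ∣ B ∣

-- D is the ordered sum of the chains B i over i in I: layer x is the index of
-- the summand of x, and ι i is the inclusion of the summand B i.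
record Layering (D I : Chain 0ℓ) (B : ∣ I ∣ → Chain 0ℓ) : Set where
  field
    strict     : ∀ {i j} → I ⊢ i ≈ j → i ≡ j
    layer      : ∣ D ∣ → ∣ I ∣
    layer-mono : ∀ {x y} → D ⊢ x ≤ y → I ⊢ layer x ≤ layer y
    ι          : ∀ i → ∣ B i ∣ → ∣ D ∣
    ι-mono     : ∀ {i x y} → B i ⊢ x ≤ y → D ⊢ ι i x ≤ ι i y
    ι-cancel   : ∀ {i x y} → D ⊢ ι i x ≤ ι i y → B i ⊢ x ≤ y
    layer-ι    : ∀ {i} x → layer (ι i x) ≡ i
    onto       : ∀ x → ∃[ y ] D ⊢ ι (layer x) y ≈ x

module _ (em : ExcludedMiddle 0ℓ) {D I : Chain 0ℓ} {B : ∣ I ∣ → Chain 0ℓ}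
         (L : Layering D I B) (n : ℕ) (block : ∀ i → Block n (B i)) where
  private
    module D = TotalOrder D
    module I = TotalOrder I
    module D/ρ m = TotalOrder (D /ρ m)
    open Layering L
    module Block′ i = Block (block i)

  onto′ : ∀ {x i} → layer x ≡ i → ∃[ y ] D ⊢ ι i y ≈ x
  onto′ refl = onto _

  layer-antisym : ∀ {x y} → I ⊢ layer x ≤ layer y → D ⊢ y ≤ x → layer x ≡ layer y
  layer-antisym p y≤x = strict (I.antisym p (layer-mono y≤x))

  summand : ∀ i → Embedding (B i) D
  summand i = record
    { to     = ι i
    ; mono   = ι-mono
    ; cancel = ι-cancel
    ; convex = λ {x} {z} y p q → onto′ (strict (I.antisym
        (subst (λ j → I ⊢ layer y ≤ j) (layer-ι z) (layer-mono q))
        (subst (λ j → I ⊢ j ≤ layer y) (layer-ι x) (layer-mono p))))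
    }

  -- For x below y in different layers, suppose that finitely many classes of
  -- ρ_m cover the interval from x to y.  This interval contains the rest of the
  -- layer of x, which would then have a last m-component.
  separated : ∀ m → (∀ i → Unbounded m (B i)) → ∀ {x y} → D ⊢ x ≤ y →
              layer x ≢ layer y → ¬ (D ⊢ x ~[ m ] y)
  separated zero _ x≤y x≢y x≈y =
    x≢y (layer-antisym (layer-mono x≤y) (D.reflexive (D.Eq.sym x≈y)))
  separated (suc m) unbounded {x} {y} x≤y x≢y (zs , covers) =
    let (p , (b , b~p) , p-greatest) = greatest (D /ρ m) em P P-resp zs x (proj₁ x∈B , P-x) P-covered
        (b′ , b≤b′ , b≁b′) = unbounded i b
        b′≲b = D/ρ.trans m {ι i b′} {p} {ι i b} (p-greatest (ι i b′) (b′ , ~-refl D m))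
                                                (inj₂ (~-sym D m b~p))
    in b≁b′ (TotalOrder.antisym (B i /ρ m) b≤b′ (cancel/ (summand i) em m b′≲b))
    where
    i   = layer x
    x∈B = onto x
    P-x = ~-reflexive D m (proj₂ x∈B)

    -- The classes which meet the layer of x.
    P : ∣ D ∣ → Set
    P z = ∃[ b ] D ⊢ ι i b ~[ m ] z

    P-resp : ∀ {u v} → D ⊢ u ~[ m ] v → P u → P v
    P-resp u~v (b , p) = b , ~-trans D m p u~v

    below-y : ∀ b → D ⊢ ι i b ≤ y
    below-y b with D.total (ι i b) y
    ... | inj₁ p = p
    ... | inj₂ p = contradiction
      (strict (I.antisym (layer-mono x≤y)
                         (subst (λ j → I ⊢ layer y ≤ j) (layer-ι b) (layer-mono p))))
      x≢y

    P-covered : ∀ z → P z → D /ρ m ⊢ x ≤ z → _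
    P-covered z (b , b~z) x≲z = covers z (inj₁
      (x≲z , D/ρ.trans m {z} {ι i b} {y} (inj₂ (~-sym D m b~z)) (inj₁ (below-y b))))

  ~⇒same-layer : ∀ {x y} → D ⊢ x ~[ n ] y → layer x ≡ layer y
  ~⇒same-layer {x} {y} x~y with em {layer x ≡ layer y}
  ... | yes p = p
  ... | no ¬p with D.total x y
  ...   | inj₁ x≤y = contradiction x~y (separated n Block′.unbounded x≤y ¬p)
  ...   | inj₂ y≤x = contradiction (~-sym D n x~y)
                       (separated n Block′.unbounded y≤x (¬p ∘ sym))

  same-layer⇒~ : ∀ {x y} → layer x ≡ layer y → D ⊢ x ~[ n ] y
  same-layer⇒~ {x} {y} p =
    let (u , u≈x) = onto x
        (v , v≈y) = onto′ (sym p)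
    in ~-trans D n (~-sym D n (~-reflexive D n u≈x))
         (~-trans D n (preserve (summand (layer x)) n (Block′.whole (layer x) u v))
                      (~-reflexive D n v≈y))

  layering-quotient : D /ρ n ≅ I
  layering-quotient = mkIso (D /ρ n) I layer mono cancel
      (λ i → ι i (Block′.point i)
           , subst (λ j → I ⊢ j ≈ i) (sym (layer-ι (Block′.point i))) I.Eq.refl)
    where
    mono : ∀ x y → D /ρ n ⊢ x ≤ y → I ⊢ layer x ≤ layer y
    mono x y (inj₁ x≤y) = layer-mono x≤y
    mono x y (inj₂ x~y) = subst (λ i → I ⊢ layer x ≤ i) (~⇒same-layer x~y) I.refl

    cancel : ∀ x y → I ⊢ layer x ≤ layer y → D /ρ n ⊢ x ≤ y
    cancel x y p with D.total x y
    ... | inj₁ x≤y = inj₁ x≤y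
    ... | inj₂ y≤x = inj₂ (same-layer⇒~ (layer-antisym p y≤x))

  layering-component : ∀ x → component D n x ≅ B (layer x)
  layering-component x =
    let (u , u≈x) = onto x in
    ≅-trans (component-cong D n (~-sym D n (~-reflexive D n u≈x)))
      (≅-trans (≅-sym (component-≅ (summand (layer x)) em n u
                 λ y p → onto′ (trans (sym (~⇒same-layer p)) (layer-ι u))))
               (component-whole (B (layer x)) n u (Block′.whole (layer x) u)))

-- A chain whose quotient by ρ_n is locally finite and endless, such as ℕ or ℤ,
-- is a block of the next rank.
quotient⇒block : ∀ {n} {D I : Chain 0ℓ} → LocallyFinite I → Endless I →
                 ∣ D ∣ → D /ρ n ≅ I → Block (suc n) D
quotient⇒block finite endless x e = record
  { whole     = locallyFinite-≅ e finite
  ; unbounded = endless-≅ e endless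
  ; point     = x
  }

-- The structure of the chains 𝒜(s)

·ℤ-layering : (B : Chain 0ℓ) → Layering (B ·ℤ) ℤ-chain (λ _ → B)
·ℤ-layering B = record
  { strict     = id
  ; layer      = proj₁
  ; layer-mono = λ where
      (inj₁ (i≤j , _)) → i≤j
      (inj₂ (i≡j , _)) → ℤ.≤-reflexive i≡j
  ; ι          = _,_
  ; ι-mono     = λ p → inj₂ (refl , p)
  ; ι-cancel   = λ where
      (inj₁ (_ , i≢i)) → contradiction refl i≢i
      (inj₂ (_ , p))   → p
  ; layer-ι    = λ _ → refl
  ; onto       = λ (_ , b) → b , refl , TotalOrder.Eq.refl B
  }

-- The summands of B′ + Bℕ.
initial-or-later : Chain 0ℓ → Chain 0ℓ → ℕ → Chain 0ℓ
initial-or-later B′ B zero    = B′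
initial-or-later B′ B (suc _) = B

⊕·ℕ-layering : (B′ B : Chain 0ℓ) → Layering (B′ ⊕ B ·ℕ) ℕ-chain (initial-or-later B′ B)
⊕·ℕ-layering B′ B = record
  { strict     = id
  ; layer      = layer
  ; layer-mono = λ where
      ₁∼₂                      → z≤n
      (₁∼₁ _)                  → z≤n
      (₂∼₂ (inj₁ (i≤j , _)))   → ℕ.s≤s i≤j
      (₂∼₂ (inj₂ (i≡j , _)))   → ℕ.s≤s (ℕ.≤-reflexive i≡j)
  ; ι          = ι
  ; ι-mono     = λ {i} → ι-mono i
  ; ι-cancel   = λ {i} → ι-cancel i
  ; layer-ι    = λ {i} → layer-ι i
  ; onto       = λ where
      (inj₁ b)       → b , inj₁ (TotalOrder.Eq.refl B′)
      (inj₂ (_ , b)) → b , inj₂ (refl , TotalOrder.Eq.refl B)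
  }
  where
  layer : ∣ B′ ⊕ B ·ℕ ∣ → ℕ
  layer (inj₁ _)       = 0
  layer (inj₂ (i , _)) = suc i

  ι : ∀ i → ∣ initial-or-later B′ B i ∣ → ∣ B′ ⊕ B ·ℕ ∣
  ι zero    b = inj₁ b
  ι (suc i) b = inj₂ (i , b)

  ι-mono : ∀ i {x y} → initial-or-later B′ B i ⊢ x ≤ y → (B′ ⊕ B ·ℕ) ⊢ ι i x ≤ ι i y
  ι-mono zero    p = ₁∼₁ p
  ι-mono (suc i) p = ₂∼₂ (inj₂ (refl , p))

  ι-cancel : ∀ i {x y} → (B′ ⊕ B ·ℕ) ⊢ ι i x ≤ ι i y → initial-or-later B′ B i ⊢ x ≤ y
  ι-cancel zero    (₁∼₁ p)                = p
  ι-cancel (suc i) (₂∼₂ (inj₁ (_ , i≢i))) = contradiction refl i≢i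
  ι-cancel (suc i) (₂∼₂ (inj₂ (_ , p)))   = p

  layer-ι : ∀ i x → layer (ι i x) ≡ i
  layer-ι zero    _ = refl
  layer-ι (suc i) _ = refl

-- The two cases in the definition of 𝒜(t ⌢ b ⌢ a), seen through the
-- arrangement of the n-components.
data 𝒜-Shape {n} (t : 𝒮 n) (b : Fin (suc n)) (D : Chain 0ℓ) : Fin (suc (suc n)) → Set where
  top    : ℤ-Shape n D (𝒜 (t ⌢ b)) → 𝒜-Shape t b D (fromℕ (suc n))
  nontop : ∀ a′ → ℕ-Shape n D (𝒜 (t ⌢ a′)) (𝒜 (t ⌢ b)) → 𝒜-Shape t b D (inject₁ a′)

module _ (em : ExcludedMiddle 0ℓ) where

  𝒜-block : ∀ n (s : 𝒮 (suc n)) → Block n (𝒜 s)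
  𝒜-shape : ∀ n (t : 𝒮 n) b a → 𝒜-Shape t b (𝒜 (t ⌢ b ⌢ a)) a

  𝒜-block zero    (⟨⟩ ⌢ zero)  = record { whole = λ _ _ → refl ; unbounded = tt ; point = tt }
  𝒜-block (suc n) (t ⌢ b ⌢ a) with 𝒜-shape n t b a
  ... | top S = quotient⇒block finite-ℤ endless-ℤ (Iso.from (ℤ-Shape.quotient S) 0ℤ)
                  (ℤ-Shape.quotient S)
  ... | nontop a′ S = quotient⇒block finite-ℕ endless-ℕ (Iso.from (ℕ-Shape.quotient S) 0)
                        (ℕ-Shape.quotient S)

  𝒜-shape n t b a with view a
  ... | ‵fromℕ = top record
    { quotient = layering-quotient em L n blocks
    ; parts    = layering-component em L n blocks
    }
    where
    L = ·ℤ-layering (𝒜 (t ⌢ b))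

    blocks : ∀ i → Block n (𝒜 (t ⌢ b))
    blocks _ = 𝒜-block n (t ⌢ b)
  ... | ‵inject₁ a′ = nontop a′ record
    { quotient = layering-quotient em L n blocks
    ; initial  = λ x p → subst (λ i → component D n x ≅ B i) p (layering-component em L n blocks x)
    ; later    = λ x p → later p (layering-component em L n blocks x)
    }
    where
    L = ⊕·ℕ-layering (𝒜 (t ⌢ a′)) (𝒜 (t ⌢ b))
    D = 𝒜 (t ⌢ a′) ⊕ 𝒜 (t ⌢ b) ·ℕ
    B = initial-or-later (𝒜 (t ⌢ a′)) (𝒜 (t ⌢ b))

    blocks : ∀ i → Block n (B i)
    blocks zero    = 𝒜-block n (t ⌢ a′)
    blocks (suc _) = 𝒜-block n (t ⌢ b)

    later : ∀ {i x} → i ≢ 0 → component D n x ≅ B i → component D n x ≅ 𝒜 (t ⌢ b)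
    later {zero}  i≢0 _ = contradiction refl i≢0
    later {suc _} _   e = e

  -- The sequence s can be recovered from 𝒜(s).
  𝒜-injective : ∀ n (s s′ : 𝒮 (suc n)) → 𝒜 s ≅ 𝒜 s′ → s ≡ s′
  𝒜-injective zero    (⟨⟩ ⌢ zero) (⟨⟩ ⌢ zero) _ = refl
  𝒜-injective (suc n) (t ⌢ b ⌢ a) (t′ ⌢ b′ ⌢ a′) e
    with 𝒜-shape n t b a | 𝒜-shape n t′ b′ a′
  ... | top S | top S′
    with refl ← 𝒜-injective n (t ⌢ b) (t′ ⌢ b′) (ℤ-Shape-parts S (ℤ-Shape-≅ em e S′)) = refl
  ... | top S | nontop _ S′ =
    ℕ≇ℤ (ℕ-Shape.quotient (ℕ-Shape-≅ em e S′)) (ℤ-Shape.quotient S)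
  ... | nontop _ S | top S′ =
    ℕ≇ℤ (ℕ-Shape.quotient S) (ℤ-Shape.quotient (ℤ-Shape-≅ em e S′))
  ... | nontop c S | nontop c′ S′
    with refl ← 𝒜-injective n (t ⌢ b) (t′ ⌢ b′) (ℕ-Shape-later S (ℕ-Shape-≅ em e S′))
       | refl ← 𝒜-injective n (t ⌢ c) (t′ ⌢ c′) (ℕ-Shape-initial S (ℕ-Shape-≅ em e S′)) = refl

𝒜-ℤ-Shape : ExcludedMiddle 0ℓ → ∀ n (t : 𝒮 n) b →
            ℤ-Shape n (𝒜 (t ⌢ b ⌢ fromℕ (suc n))) (𝒜 (t ⌢ b))
𝒜-ℤ-Shape em n t b = go (𝒜-shape em n t b (fromℕ (suc n))) refl
  where
  go : ∀ {D a} → 𝒜-Shape t b D a → a ≡ fromℕ (suc n) → ℤ-Shape n D (𝒜 (t ⌢ b))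
  go (top S)      _ = S
  go (nontop _ _) p = contradiction (sym p) Fin.fromℕ≢inject₁

𝒜-ℕ-Shape : ExcludedMiddle 0ℓ → ∀ n (t : 𝒮 n) b a →
            ℕ-Shape n (𝒜 (t ⌢ b ⌢ inject₁ a)) (𝒜 (t ⌢ a)) (𝒜 (t ⌢ b))
𝒜-ℕ-Shape em n t b a = go (𝒜-shape em n t b (inject₁ a)) refl
  where
  go : ∀ {D a′} → 𝒜-Shape t b D a′ → a′ ≡ inject₁ a → ℕ-Shape n D (𝒜 (t ⌢ a)) (𝒜 (t ⌢ b))
  go (top _)      p = contradiction p Fin.fromℕ≢inject₁
  go (nontop _ S) p with refl ← Fin.inject₁-injective p = S

-- Counting predecessors

module _ {Q : Chain c} where
  private
    module Q = TotalOrder Q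

  predecessors-≤ : ∀ {x i j} → HasPredecessors Q x i → HasPredecessors Q x j → i ℕ.≤ j
  predecessors-≤ f g = Fin.injective⇒≤ {f = λ k → proj₁ (G.surjective (F.to k))} λ {k} {l} p →
      F.injective (Q.Eq.trans (Q.Eq.sym (proj₂ (G.surjective (F.to k)) refl))
                              (proj₂ (G.surjective (F.to l)) p))
    where
    module F = Bijection f
    module G = Bijection g

  module _ (e : Q ≅ ℕ-chain) where
    private
      module E = Iso e

    hasPredecessors : ∀ x {i} → E.to x ≡ i → HasPredecessors Q x i
    hasPredecessors x refl = record
      { to        = λ k → E.from (toℕ k) , below k , λ p →
          ℕ.<-irrefl (trans (sym (E.to-from (toℕ k))) (E.cong p)) (Fin.toℕ<n k)
      ; cong      = λ { refl → Q.Eq.refl }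
      ; bijective =
            (λ {k} {l} p → Fin.toℕ-injective
              (trans (sym (E.to-from (toℕ k))) (trans (E.cong p) (E.to-from (toℕ l)))))
          , λ (y , y≤x , y≉x) →
              let y<x = ℕ.≤∧≢⇒< (E.mono y≤x) (y≉x ∘ E.injective) in
              fromℕ< y<x , λ { refl → E.injective (trans (E.to-from _) (Fin.toℕ-fromℕ< y<x)) }
      }
      where
      below : ∀ (k : Fin (E.to x)) → Q ⊢ E.from (toℕ k) ≤ x
      below k = E.cancel (ℕ.≤-trans (ℕ.≤-reflexive (E.to-from (toℕ k))) (ℕ.<⇒≤ (Fin.toℕ<n k)))

    -- The number of predecessors determines a point of ℕ.
    position : ∀ {x i} → HasPredecessors Q x i → E.to x ≡ i
    position {x} h = ℕ.≤-antisym (predecessors-≤ (hasPredecessors x refl) h)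
                                 (predecessors-≤ h (hasPredecessors x refl))

-- Least numbers and derived sequences

least : ExcludedMiddle 0ℓ → (P : ℕ → Set) → ∀ n → P n → ∃[ m ] P m × (∀ k → P k → m ℕ.≤ k)
least em P n Pn = greatest (ℕ-chain ᵒᵖ) em P (subst P) (proj₁ (finite-ℕ 0 n)) n Pn
  λ k _ k≤n → proj₂ (finite-ℕ 0 n) k (inj₁ (z≤n , k≤n))

Positive : ω+1 → Set
Positive i = [ 0 ] <⁺ i

not-positive : ∀ i → ¬ Positive i → i ≡ [ 0 ]
not-positive [ zero ]  _ = refl
not-positive [ suc i ] h = contradiction [ s≤s z≤n ] h
not-positive ω         h = contradiction [ 0 ]<⊤⁺ h

zero-or-positive : ∀ i → i ≡ [ 0 ] ⊎ Positive i
zero-or-positive [ zero ]  = inj₁ refl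
zero-or-positive [ suc i ] = inj₂ [ s≤s z≤n ]
zero-or-positive ω         = inj₂ [ 0 ]<⊤⁺

nextPositive : ExcludedMiddle 0ℓ → ∀ (π : ℕ → ω+1) n → ∃[ w ] IsNextPositive π n w
nextPositive em π n with em {∃[ v ] n ℕ.≤ v × Positive (π v)}
... | yes (v , p) = let (m , (n≤m , pos) , h) = least em (λ v → n ℕ.≤ v × Positive (π v)) v p in
  [ m ] , n≤m , pos , λ u n≤u q → h u (n≤u , q)
... | no ¬p = ω , λ v n≤v q → ¬p (v , n≤v , q)

lower-toℕ : ∀ {n} j (p : j ≤⁺ [ n ]) → j ≡ [ toℕ (lower j p) ]
lower-toℕ [ j ] [ j≤n ] = cong [_] (sym (Fin.toℕ-fromℕ< (s≤s j≤n)))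

lower-≡ : ∀ {n j} {k : Fin (suc n)} (p : j ≤⁺ [ n ]) → j ≡ [ toℕ k ] → lower j p ≡ k
lower-≡ [ p ] refl = Fin.toℕ-injective (Fin.toℕ-fromℕ< (s≤s p))

derived-unique : ExcludedMiddle 0ℓ → ∀ {σ π} {c : Compatible σ π} {s s′} →
                 Derived c s → Derived c s′ → ∀ n → s n ≡ s′ n
derived-unique em {π = π} D D′ n with zero-or-positive (π n)
... | inj₂ p = trans (Derived.positive D n p) (sym (Derived.positive D′ n p))
... | inj₁ p = let (w , next) = nextPositive em π n in
  trans (Derived.null D n p w next) (sym (Derived.null D′ n p w next))

⌢-eta : ∀ {n} (s : 𝒮 (suc n)) → s ≡ (s ⁻) ⌢ last s
⌢-eta (_ ⌢ _) = refl

-- A point of the 0th component of 𝒜(s) = 𝒜(s⁻)ℤ.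
zeroth : ExcludedMiddle 0ℓ → ∀ n (t : 𝒮 n) b a → a ≡ fromℕ (suc n) →
         Σ[ z ∈ ∣ 𝒜 (t ⌢ b ⌢ a) ∣ ] Zeroth (t ⌢ b ⌢ a) z
zeroth em n t b a p with view a
... | ‵fromℕ      = (0ℤ , Block.point (𝒜-block em n (t ⌢ b))) , refl
... | ‵inject₁ a′ = contradiction (sym p) Fin.fromℕ≢inject₁

-- The components of a point

module Components (em : ExcludedMiddle ℓ) (A : Chain ℓ) (x : ∣ A ∣) where
  private
    module A = TotalOrder A

    em₀ : ExcludedMiddle 0ℓ
    em₀ = lowerEM ℓ em

  -- C n = [x]_n, and o n is x as a point of it.
  C : ℕ → Chain ℓ
  C n = component A n x

  o : ∀ n → ∣ C n ∣
  o n = centre A n x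

  centre-component : ∀ n → component (C (suc n)) n (o (suc n)) ≅ C n
  centre-component n = component-component A em n x (o (suc n))

  -- How [x]_n sits inside [x]_{n+1} ≅ 𝒜(t ⌢ b ⌢ a): anywhere in the case of ℤ,
  -- and as the initial or a later n-component in the case of ℕ.
  data Step n (t : 𝒮 n) (b : Fin (suc n)) : Fin (suc (suc n)) → Set ℓ where
    anywhere  : (∀ i → ¬ Predecessors A x n i) → C n ≅ 𝒜 (t ⌢ b) → Step n t b (fromℕ (suc n))
    initially : ∀ a′ → Predecessors A x n 0 → C n ≅ 𝒜 (t ⌢ a′) → Step n t b (inject₁ a′)
    later     : ∀ a′ i → Predecessors A x n (suc i) → C n ≅ 𝒜 (t ⌢ b) → Step n t b (inject₁ a′)

  step : ∀ n t b a → C (suc n) ≅ 𝒜 (t ⌢ b ⌢ a) → Step n t b a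
  step n t b a e with 𝒜-shape em₀ n t b a
  ... | top S = anywhere
      (λ i (f , _) → ℕ≇ℤ f (ℤ-Shape.quotient S′))
      (≅-trans (≅-sym (centre-component n)) (ℤ-Shape.parts S′ (o (suc n))))
    where S′ = ℤ-Shape-≅ em e S
  ... | nontop a′ S = choose (S′.level (o (suc n))) refl
    where
    module S′ = ℕ-Shape (ℕ-Shape-≅ em e S)

    choose : ∀ i → S′.level (o (suc n)) ≡ i → Step n t b (inject₁ a′)
    choose zero p = initially a′
      (S′.quotient , hasPredecessors S′.quotient (o (suc n)) p)
      (≅-trans (≅-sym (centre-component n)) (S′.initial (o (suc n)) p))
    choose (suc i) p = later a′ i
      (S′.quotient , hasPredecessors S′.quotient (o (suc n)) p)
      (≅-trans (≅-sym (centre-component n))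
        (S′.later (o (suc n)) λ q → contradiction (trans (sym p) q) λ ()))

  module EmbeddingSequence {π : ℕ → ω+1} (E : IsEmbeddingSequence A x π) where
    private module E = IsEmbeddingSequence E

    π-finite : ∀ {n i} → Predecessors A x n i → π n ≡ [ i ]
    π-finite {n} {i} (f , h) with π n in eq
    ... | [ j ] = cong [_] (trans (sym (position f (proj₂ (E.finite n j eq)))) (position f h))
    ... | ω     = contradiction (f , h) (E.infinite n eq i)

    π-infinite : ∀ {n} → (∀ i → ¬ Predecessors A x n i) → π n ≡ ω
    π-infinite {n} h with π n in eq
    ... | [ j ] = contradiction (E.finite n j eq) (h j)
    ... | ω     = refl

    -- The requirements on a target z in 𝒜(v) in a direct system, where
    -- v = s_{n+1}.
    record Target n (v : 𝒮 (suc (suc n))) (z : ∣ 𝒜 v ∣) : Set where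
      field
        finite   : ∀ i → π n ≡ [ i ] → 𝒜 v /ρ n ≅ ℕ-chain × HasPredecessors (𝒜 v /ρ n) z i
        infinite : π n ≡ ω → 𝒜 v /ρ n ≅ ℤ-chain × Zeroth v z

    -- The image of x is a target, except in the case of ℤ, where it need not lie
    -- in the 0th component; but there all n-components are isomorphic.
    target : ∀ n (u : 𝒮 (suc n)) (v : 𝒮 (suc (suc n))) → C n ≅ 𝒜 u → C (suc n) ≅ 𝒜 v →
             ∃[ z ] (𝒜 u ≅ component (𝒜 v) n z) × Target n v z
    target n u (t ⌢ b ⌢ a) f g with 𝒜-shape em₀ n t b a
    ... | top S =
        z , ≅-trans iso (≅-trans (S.parts (Iso.to g (o (suc n)))) (≅-sym (S.parts z))) , record
      { finite   = λ i p → ℕ≇ℤ (proj₁ (E.finite n i p)) (ℤ-Shape.quotient (ℤ-Shape-≅ em g S))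
      ; infinite = λ _ → S.quotient , z-zeroth
      }
      where
      module S = ℤ-Shape S
      z        = proj₁ (zeroth em₀ n t b a refl)
      z-zeroth = proj₂ (zeroth em₀ n t b a refl)
      iso      = ≅-trans (≅-sym f) (≅-trans (≅-sym (centre-component n))
                   (component-iso em g n (o (suc n))))
    ... | nontop a′ S = z , iso , record
      { finite   = λ i p → S.quotient , hasPredecessors S.quotient z
          (position S′.quotient (proj₂ (E.finite n i p)))
      ; infinite = λ p → contradiction
          (S′.quotient , hasPredecessors S′.quotient (o (suc n)) refl) (E.infinite n p _)
      }
      where
      module S  = ℕ-Shape S
      module S′ = ℕ-Shape (ℕ-Shape-≅ em g S)
      z   = Iso.to g (o (suc n))
      iso = ≅-trans (≅-sym f) (≅-trans (≅-sym (centre-component n))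
              (component-iso em g n (o (suc n))))

    module _ {n} {v : 𝒮 (suc (suc n))} {z : ∣ 𝒜 v ∣} (T : Target n v z) where
      private module T = Target T

      -- [x]_{n+1} ≅ 𝒜(v) may be assumed to map [x]_n onto the component of
      -- the target: this is automatic in the case of ℕ, and a matter of
      -- shifting in the case of ℤ.
      align : C (suc n) ≅ 𝒜 v → Σ[ g ∈ C (suc n) ≅ 𝒜 v ] 𝒜 v ⊢ Iso.to g (o (suc n)) ~[ n ] z
      align g = by-π (π n) refl
        where
        by-π : ∀ i → π n ≡ i → Σ[ g ∈ C (suc n) ≅ 𝒜 v ] 𝒜 v ⊢ Iso.to g (o (suc n)) ~[ n ] z
        by-π [ i ] p =
          let (h , q) = T.finite i p in
          g , Iso.injective h (trans
            (position (≅-trans (quotient-iso em g n) h) (proj₂ (E.finite n i p)))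
            (sym (position h q)))
        by-π ω p = shifted v (proj₁ (T.infinite p)) g z
          where
          shifted : ∀ v → 𝒜 v /ρ n ≅ ℤ-chain → C (suc n) ≅ 𝒜 v → ∀ z →
                    Σ[ g ∈ C (suc n) ≅ 𝒜 v ] 𝒜 v ⊢ Iso.to g (o (suc n)) ~[ n ] z
          shifted (t ⌢ b ⌢ a) q g z with 𝒜-shape em₀ n t b a
          ... | top S      = ℤ-Shape-unique em (ℤ-Shape-≅ em g S) S (o (suc n)) z
          ... | nontop _ S = ℕ≇ℤ (ℕ-Shape.quotient S) q

      module _ {u : 𝒮 (suc n)} (f : C n ≅ 𝒜 u) (e : 𝒜 u ≅ component (𝒜 v) n z) where

        -- The isomorphism f of n-components extends to C (suc n) along the
        -- embedding e: an isomorphism g aligned with the target z is overridden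
        -- on [x]_n by e after f.
        extend : C (suc n) ≅ 𝒜 v → Σ[ f′ ∈ C (suc n) ≅ 𝒜 v ]
                   ∀ y p q → 𝒜 v ⊢ proj₁ (Iso.to e (Iso.to f (y , p))) ≈ Iso.to f′ (y , q)
        extend g₀ =
            glue em n (C (suc n)) (𝒜 v) (quotient-iso em g n)
                 (λ y → move y em) (λ y → move~ y em)
                 (λ y y′ → move-mono y y′ em em) (λ y y′ → move-cancel y y′ em em) onto
          , λ y p q → agrees y p q em
          where
          module V = TotalOrder (𝒜 v)
          aligned = align g₀
          g       = proj₁ aligned
          module G = Iso g

          inside : ∀ y → A ⊢ x ~[ n ] proj₁ y → C (suc n) ⊢ o (suc n) ~[ n ] y
          inside y = reflect (component-inclusion (suc n) x) em n

          outside : ∀ y → C (suc n) ⊢ o (suc n) ~[ n ] y → A ⊢ x ~[ n ] proj₁ y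
          outside y = preserve (component-inclusion (suc n) x) n

          g-inside : ∀ y → A ⊢ x ~[ n ] proj₁ y → 𝒜 v ⊢ z ~[ n ] G.to y
          g-inside y p = ~-trans (𝒜 v) n (~-sym (𝒜 v) n (proj₂ aligned))
                           (preserve (embedding g) n (inside y p))

          f→ : ∀ y → A ⊢ x ~[ n ] y → ∣ 𝒜 v ∣
          f→ y p = proj₁ (Iso.to e (Iso.to f (y , p)))

          -- The extension, by cases on whether y lies in [x]_n.
          move : ∀ y → Dec (A ⊢ x ~[ n ] proj₁ y) → ∣ 𝒜 v ∣
          move y (yes p) = f→ (proj₁ y) p
          move y (no _)  = G.to y

          move~ : ∀ y d → 𝒜 v ⊢ move y d ~[ n ] G.to y
          move~ y (yes p) = ~-trans (𝒜 v) n
            (~-sym (𝒜 v) n (proj₂ (Iso.to e (Iso.to f (proj₁ y , p))))) (g-inside y p)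
          move~ y (no _)  = ~-refl (𝒜 v) n

          along : ∀ y y′ → C (suc n) ⊢ y ~[ n ] y′ → A ⊢ x ~[ n ] proj₁ y → A ⊢ x ~[ n ] proj₁ y′
          along y y′ y~y′ p = outside y′ (~-trans (C (suc n)) n (inside y p) y~y′)

          move-mono : ∀ y y′ d d′ → C (suc n) ⊢ y ~[ n ] y′ → C (suc n) ⊢ y ≤ y′ →
                      𝒜 v ⊢ move y d ≤ move y′ d′
          move-mono y y′ (yes _) (yes _)  _    y≤y′ = Iso.mono e (Iso.mono f y≤y′)
          move-mono y y′ (no _)  (no _)   _    y≤y′ = G.mono y≤y′
          move-mono y y′ (yes p) (no ¬p)  y~y′ _    = contradiction (along y y′ y~y′ p) ¬p
          move-mono y y′ (no ¬p) (yes p)  y~y′ _    =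
            contradiction (along y′ y (~-sym (C (suc n)) n y~y′) p) ¬p

          move-cancel : ∀ y y′ d d′ → C (suc n) ⊢ y ~[ n ] y′ → 𝒜 v ⊢ move y d ≤ move y′ d′ →
                        C (suc n) ⊢ y ≤ y′
          move-cancel y y′ (yes _) (yes _)  _    q = Iso.cancel f (Iso.cancel e q)
          move-cancel y y′ (no _)  (no _)   _    q = G.cancel q
          move-cancel y y′ (yes p) (no ¬p)  y~y′ _ = contradiction (along y y′ y~y′ p) ¬p
          move-cancel y y′ (no ¬p) (yes p)  y~y′ _ =
            contradiction (along y′ y (~-sym (C (suc n)) n y~y′) p) ¬p

          agrees : ∀ y p q d → 𝒜 v ⊢ f→ y p ≈ move (y , q) d
          agrees y p q (yes p′) = Iso.cong e (Iso.cong f A.Eq.refl)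
          agrees y p q (no ¬p)  = contradiction p ¬p

          agrees-outside : ∀ y → ¬ (A ⊢ x ~[ n ] proj₁ y) → ∀ d → 𝒜 v ⊢ move y d ≈ G.to y
          agrees-outside y ¬p (yes p) = contradiction p ¬p
          agrees-outside y ¬p (no _)  = V.Eq.refl

          onto : ∀ w → ∃[ y ] 𝒜 v ⊢ move y em ≈ w
          onto w with em₀ {𝒜 v ⊢ z ~[ n ] w}
          ... | yes z~w =
            let k       = Iso.from e (w , z~w)
                (y , p) = Iso.from f k
                q       = ~-suc A n p
            in (y , q) , V.Eq.trans (V.Eq.sym (agrees y p q em))
                 (V.Eq.trans (Iso.cong e (Iso.to-from f k)) (Iso.to-from e (w , z~w)))
          ... | no z≁w =
            let y = G.from w in
            y , V.Eq.trans
              (agrees-outside y (λ p → z≁w (~-trans (𝒜 v) n (g-inside y p)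
                                              (~-reflexive (𝒜 v) n (G.to-from w)))) em)
              (G.to-from w)

module _ (em : ExcludedMiddle ℓ) (A : Chain ℓ) (x : ∣ A ∣) where
  private
    module A = TotalOrder A
    open Components em A x

    em₀ : ExcludedMiddle 0ℓ
    em₀ = lowerEM ℓ em

  -- The trunk

  module Trunk {π : ℕ → ω+1} {σ : 𝒮ω+1}
               (E : IsEmbeddingSequence A x π) (T : IsTrunk A x π σ) where
    private
      module T = IsTrunk T
      open EmbeddingSequence E
      open T using (s)

      -- σ(n), as an entry at position n.
      σ⟨_⟩ : ∀ n → Fin (suc n)
      σ⟨ n ⟩ = lower (at σ [ n ]) (bounded σ [ n ])

      -- The last entry s_n(n).
      entry : ℕ → ℕ
      entry n = toℕ (last (s n))

    s-⁻ : ∀ n → s n ⁻ ≡ σ ↾ n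
    s-⁻ zero with s 0
    ... | ⟨⟩ ⌢ _ = refl
    s-⁻ (suc n) = sym (T.below n)

    s≡ : ∀ n → s n ≡ (σ ↾ n) ⌢ last (s n)
    s≡ n = trans (⌢-eta (s n)) (cong (_⌢ last (s n)) (s-⁻ n))

    s-unique : ∀ {n} u → C n ≅ 𝒜 u → s n ≡ u
    s-unique {n} u f = 𝒜-injective em₀ n (s n) u (≅-trans (≅-sym (T.iso n)) f)

    trunk-step : ∀ n → Step n (σ ↾ n) σ⟨ n ⟩ (last (s (suc n)))
    trunk-step n = step n _ _ _ (subst (λ u → C (suc n) ≅ 𝒜 u) (s≡ (suc n)) (T.iso (suc n)))

    s-positive : ∀ n → Positive (π n) → s n ≡ σ ↾ suc n
    s-positive n p with last (s (suc n)) | trunk-step n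
    ... | _ | anywhere _ f    = s-unique (σ ↾ suc n) f
    ... | _ | later _ _ _ f   = s-unique (σ ↾ suc n) f
    ... | _ | initially _ h _ with [ () ] ← subst Positive (π-finite h) p

    entry-null : ∀ n → π n ≡ [ 0 ] → entry n ≡ entry (suc n)
    entry-null n p with last (s (suc n)) | trunk-step n
    ... | _ | anywhere h _ with () ← trans (sym p) (π-infinite h)
    ... | _ | later _ _ h _ with () ← trans (sym p) (π-finite h)
    ... | _ | initially a′ _ f =
      trans (cong (toℕ ∘ last) (s-unique ((σ ↾ n) ⌢ a′) f)) (sym (Fin.toℕ-inject₁ a′))

    entry-constant : ∀ {m n} → m ≤′ n → (∀ k → m ℕ.≤ k → k ℕ.< n → π k ≡ [ 0 ]) →
                     entry m ≡ entry n
    entry-constant (≤′-reflexive refl) _    = refl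
    entry-constant (≤′-step {n} m≤n)   null = trans
      (entry-constant m≤n λ k m≤k k<n → null k m≤k (ℕ.m<n⇒m<1+n k<n))
      (entry-null n (null n (ℕ.≤′⇒≤ m≤n) ℕ.≤-refl))

    -- The last entry of s_n is σ(w_n).  If w_n = ω, it is constant from the
    -- least m on from which π vanishes, and σ(ω) = s_m(m) by definition.
    at-next : ∀ n w → IsNextPositive π n w → at σ w ≡ [ entry n ]
    at-next n [ v ] (n≤v , pos , first) = trans
      (lower-toℕ (at σ [ v ]) (bounded σ [ v ]))
      (cong [_] (trans (sym (cong (toℕ ∘ last) (s-positive v pos)))
                       (sym (entry-constant (ℕ.≤⇒≤′ n≤v) null))))
      where
      null : ∀ k → n ℕ.≤ k → k ℕ.< v → π k ≡ [ 0 ]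
      null k n≤k k<v = not-positive (π k) λ p → ℕ.<⇒≱ k<v (first k n≤k p)
    at-next n ω none =
      let (m , null , m-least) = least em₀ NullFrom n (λ k n≤k → not-positive (π k) (none k n≤k))
          m≤n = m-least n λ k n≤k → not-positive (π k) (none k n≤k)
      in trans (T.top m (null , m-least))
               (cong [_] (entry-constant (ℕ.≤⇒≤′ m≤n) λ k m≤k _ → null k m≤k))
      where
      NullFrom : ℕ → Set
      NullFrom k = ∀ n → k ℕ.≤ n → π n ≡ [ 0 ]

    nontop⇔ω : ∀ {k i} (a : Fin (suc k)) → Predecessors A x k i →
               _≡_ {A = ω+1} [ toℕ (inject₁ a) ] [ suc k ] ⇔ π k ≡ ω
    nontop⇔ω a h = mk⇔
      (λ p → contradiction (sym ([]-injective p)) (Fin.toℕ-inject₁-≢ a))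
      (λ p → contradiction (trans (sym p) (π-finite h)) λ ())

    compatible : Compatible σ π
    compatible = record
      { top⇔ω  = λ k w next → subst (λ j → j ≡ [ suc k ] ⇔ π k ≡ ω) (sym (at-next (suc k) w next))
                   (top⇔ω k)
      ; zero⇒≤ = λ n _ w next → subst (_≤⁺ [ n ]) (sym (at-next n w next))
                   [ Fin.toℕ≤pred[n] (last (s n)) ]
      }
      where
      top⇔ω : ∀ k → _≡_ {A = ω+1} [ entry (suc k) ] [ suc k ] ⇔ π k ≡ ω
      top⇔ω k with last (s (suc k)) | trunk-step k
      ... | _ | anywhere h _     = mk⇔ (λ _ → π-infinite h) (λ _ → cong [_] (Fin.toℕ-fromℕ (suc k)))
      ... | _ | initially a′ h _ = nontop⇔ω a′ h
      ... | _ | later a′ _ h _   = nontop⇔ω a′ h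

    derived : Derived compatible s
    derived = record
      { positive = s-positive
      ; null     = λ n p w next → trans (s≡ n)
                     (cong ((σ ↾ n) ⌢_) (sym (lower-≡ _ (at-next n w next))))
      }

    -- The embedding of 𝒜(s_n) into 𝒜(s_{n+1}) and its target.
    links : ∀ n → ∃[ z ] (𝒜 (s n) ≅ component (𝒜 (s (suc n))) n z) × Target n (s (suc n)) z
    links n = target n (s n) (s (suc n)) (T.iso n) (T.iso (suc n))

    system : System compatible
    system = record
      { s        = s
      ; derived  = derived
      ; target   = λ n → proj₁ (links n)
      ; iso      = λ n → proj₁ (proj₂ (links n))
      ; finite   = λ n → Target.finite (proj₂ (proj₂ (links n)))
      ; infinite = λ n → Target.infinite (proj₂ (proj₂ (links n)))
      }

    -- The direct limit

    module _ (near : ∀ y → ∃[ n ] A ⊢ x ~[ n ] y) (S : System compatible) where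
      private
        module S = System S
        module L = DirectLimit (λ n → 𝒜 (S.s n)) S.target S.iso

        B : ℕ → Chain 0ℓ
        B n = 𝒜 (S.s n)

      C≅B : ∀ n → C n ≅ B n
      C≅B n = subst (λ u → C n ≅ 𝒜 u) (derived-unique em₀ derived S.derived n) (T.iso n)

      extension : ∀ n (f : C n ≅ B n) → Σ[ f′ ∈ C (suc n) ≅ B (suc n) ]
                  ∀ y p q → B (suc n) ⊢ L.embed n (Iso.to f (y , p)) ≈ Iso.to f′ (y , q)
      extension n f = extend {v = S.s (suc n)} (record { finite = S.finite n ; infinite = S.infinite n })
                             {u = S.s n} f (S.iso n) (C≅B (suc n))

      -- Isomorphisms [x]_n ≅ 𝒜(s_n) compatible with the embeddings.
      F : ∀ n → C n ≅ B n
      F zero    = C≅B 0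
      F (suc n) = proj₁ (extension n (F n))

      F-up : ∀ {m n} (r : m ≤′ n) y p q → B n ⊢ L.up r (Iso.to (F m) (y , p)) ≈ Iso.to (F n) (y , q)
      F-up {m} (≤′-reflexive refl) y p q = Iso.cong (F m) A.Eq.refl
      F-up {m} (≤′-step {n} r)     y p q = TotalOrder.Eq.trans (B (suc n))
        (Iso.cong (S.iso n) (F-up r y p p′))
        (proj₂ (extension n (F n)) y p′ q)
        where
        p′ = ~-raise A r p

      -- F n maps y to a point of the limit that does not depend on the n with
      -- x ρ_n y.
      limit-iso : A ≅ System.limit S
      limit-iso = mkIso A S.limit to mono cancel onto
        where
        to : ∣ A ∣ → ∣ S.limit ∣
        to y = let (n , p) = near y in n , Iso.to (F n) (y , p)

        mono : ∀ y z → A ⊢ y ≤ z → S.limit ⊢ to y ≤ to z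
        mono y z y≤z =
          let (m , p) = near y
              (n , q) = near z
              r  = ℕ.m≤′m+n m n
              r′ = ℕ.n≤′m+n m n
              k  = m ℕ.+ n
              module B = TotalOrder (B k)
          in k , r , r′ ,
             B.trans (B.reflexive (F-up r y p (~-raise A r p)))
               (B.trans (Iso.mono (F k) y≤z)
                        (B.reflexive (B.Eq.sym (F-up r′ z q (~-raise A r′ q)))))

        cancel : ∀ y z → S.limit ⊢ to y ≤ to z → A ⊢ y ≤ z
        cancel y z (k , r , r′ , h) =
          let (m , p) = near y
              (n , q) = near z
              module B = TotalOrder (B k)
          in Iso.cancel (F k)
               (B.trans (B.reflexive (B.Eq.sym (F-up r y p (~-raise A r p))))
                 (B.trans h (B.reflexive (F-up r′ z q (~-raise A r′ q)))))

        onto : ∀ w → ∃[ y ] S.limit ⊢ to y ≈ w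
        onto (n , u) =
          let (y , q) = Iso.from (F n) u
              (m , p) = near y
              r  = ℕ.m≤′m+n m n
              r′ = ℕ.n≤′m+n m n
              k  = m ℕ.+ n
              module B = TotalOrder (B k)
          in y , k , r , r′ ,
             B.Eq.trans (F-up r y p (~-raise A r p))
               (B.Eq.trans (B.Eq.sym (F-up r′ y q (~-raise A r p)))
                           (L.up-cong r′ (Iso.to-from (F n) u)))

-- Uniform chains of rank ω

module UniformChain (em : ExcludedMiddle ℓ) (A : Chain ℓ) (uniform : Uniform A)
                    (rank : HasRank A ω) where
  private
    module A = TotalOrder A

    em₀ : ExcludedMiddle 0ℓ
    em₀ = lowerEM ℓ em

  point : ∣ A ∣
  point = Iso.from (proj₁ rank) tt

  near : ∀ x y → ∃[ n ] A ⊢ x ~[ n ] y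
  near x y = Iso.injective (proj₁ rank) refl

  -- The isomorphism between the final segments at x and z, as an embedding
  -- into A.
  module Shift (x z : ∣ A ∣) where
    φ : A from x ≅ A from z
    φ = uniform x z

    shifting : Embedding (A from x) A
    shifting = from-inclusion z ∘ₑ embedding φ

    module E = Embedding shifting

    bottom : ∣ A from x ∣
    bottom = x , A.refl

    shift-bottom : A ⊢ E.to bottom ≈ z
    shift-bottom = A.antisym
      (A.trans (E.mono {bottom} {w} (proj₂ w)) (A.reflexive (Iso.to-from φ (z , A.refl))))
      (proj₂ (Iso.to φ bottom))
      where w = Iso.from φ (z , A.refl)

    shift-final : ∀ u y → A ⊢ E.to u ≤ y → ∃[ w ] A ⊢ E.to w ≈ y
    shift-final u y p =
      let y′ = y , A.trans (proj₂ (Iso.to φ u)) p in Iso.from φ y′ , Iso.to-from φ y′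

  -- [x]_n is not the last n-component of [x]_{n+1}.
  Reach : ℕ → ∣ A ∣ → Set ℓ
  Reach n x = ∃[ y ] A ⊢ x ≤ y × A ⊢ x ~[ suc n ] y × ¬ (A ⊢ x ~[ n ] y)

  reach-shift : ∀ n {x z} → Reach n x → Reach n z
  reach-shift n {x} {z} (y , x≤y , x~y , x≁y) =
      E.to v , proj₂ (Iso.to φ v)
    , ~-trans A (suc n) (~-sym A (suc n) (~-reflexive A (suc n) shift-bottom))
        (preserve shifting (suc n) (reflect (from-inclusion x) em (suc n) {bottom} {v} x~y))
    , λ p → x≁y (preserve (from-inclusion x) n {bottom} {v} (reflect shifting em n
        (~-trans A n (~-reflexive A n shift-bottom) p)))
    where
    open Shift x z
    v : ∣ A from x ∣
    v = y , x≤y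

  -- If [x]_n were last in [x]_{n+1} for one x, then it would be so for all x by
  -- uniformity, and the relations ρ_m would be the same for all m ≥ n.
  reach : ∀ n x → Reach n x
  reach n x with em {Reach n x}
  ... | yes r = r
  ... | no ¬r = contradiction A/n≅𝟏 (proj₂ rank [ n ] [ n ]<⊤⁺)
    where
    merged≤ : ∀ {y z} → A ⊢ y ≤ z → A ⊢ y ~[ suc n ] z → A ⊢ y ~[ n ] z
    merged≤ {y} {z} y≤z p with em {A ⊢ y ~[ n ] z}
    ... | yes q = q
    ... | no ¬q = contradiction (reach-shift n (z , y≤z , p , ¬q)) ¬r

    merged : ∀ {y z} → A ⊢ y ~[ suc n ] z → A ⊢ y ~[ n ] z
    merged {y} {z} p with A.total y z
    ... | inj₁ y≤z = merged≤ y≤z p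
    ... | inj₂ z≤y = ~-sym A n (merged≤ z≤y (~-sym A (suc n) p))

    merge-step : ∀ k → (∀ {y z} → A ⊢ y ~[ suc k ] z → A ⊢ y ~[ k ] z) →
                 ∀ {y z} → A ⊢ y ~[ suc (suc k) ] z → A ⊢ y ~[ suc k ] z
    merge-step k h (zs , covers) = zs , λ where
        z (inj₁ (p , q)) → Any.map h (covers z (inj₁ (up p , up q)))
        z (inj₂ (p , q)) → Any.map h (covers z (inj₂ (up p , up q)))
      where
      up : ∀ {y z} → A /ρ k ⊢ y ≤ z → A /ρ suc k ⊢ y ≤ z
      up (inj₁ p) = inj₁ p
      up (inj₂ p) = inj₂ (~-suc A k p)

    merged-at : ∀ {k} → n ≤′ k → ∀ {y z} → A ⊢ y ~[ suc k ] z → A ⊢ y ~[ k ] z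
    merged-at (≤′-reflexive refl) = merged
    merged-at (≤′-step {k} p)     = merge-step k (merged-at p)

    descend : ∀ {k} → n ≤′ k → ∀ {y z} → A ⊢ y ~[ k ] z → A ⊢ y ~[ n ] z
    descend (≤′-reflexive refl) q = q
    descend (≤′-step p)         q = descend p (merged-at p q)

    all~ : ∀ y z → A ⊢ y ~[ n ] z
    all~ y z with near y z
    ... | k , p with ℕ.≤-total k n
    ...   | inj₁ k≤n = ~-raise A (ℕ.≤⇒≤′ k≤n) p
    ...   | inj₂ n≤k = descend (ℕ.≤⇒≤′ n≤k) p

    A/n≅𝟏 : A /ρ n ≅ 𝟏
    A/n≅𝟏 = mkIso (A /ρ n) 𝟏 (λ _ → tt) (λ _ _ _ → refl) (λ y z _ → inj₂ (all~ y z))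
              (λ _ → point , refl)

  next : ∀ n x → ∃[ y ] Covers (A /ρ n) x y
  next n x = let (y , x≤y , x~y , x≁y) = reach n x in
    successor em (A /ρ n) (inj₁ x≤y) x≁y x~y

  -- In A from x, the second n-component is [y]_n; hence all n-components
  -- which have an immediate predecessor are isomorphic.
  covered-≅ : ∀ n {x y x′ y′} → Covers (A /ρ n) x y → Covers (A /ρ n) x′ y′ →
              component A n y ≅ component A n y′
  covered-≅ n {x} {y} {x′} {y′} covers covers′ =
    ≅-trans (≅-sym (component-covered em (from-inclusion x) n final covers-from-x))
      (≅-trans (component-covered em shifting n shift-final covers-from-x)
        (component-cong A n (covers-unique (A /ρ n) (~-reflexive A n shift-bottom)
          (covers-preserve em shifting n covers-from-x) covers′)))
    where
    open Shift x x′
    v : ∣ A from x ∣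
    v = y , ≲∧≁⇒≤ A n (proj₁ covers) (proj₁ (proj₂ covers))

    final : ∀ u z → A ⊢ proj₁ u ≤ z → ∃[ w ] A ⊢ proj₁ w ≈ z
    final u z p = (z , A.trans (proj₂ u) p) , A.Eq.refl

    covers-from-x : Covers ((A from x) /ρ n) bottom v
    covers-from-x = covers-reflect em (from-inclusion x) n {bottom} {v} covers

  module _ (n : ℕ) (x : ∣ A ∣) where
    private
      C = component A (suc n) x
      Q = C /ρ n
      incl = component-inclusion {A = A} (suc n) x

    quotient-finite : LocallyFinite Q
    quotient-finite u v = reflect incl em (suc n) {u} {v}
      (~-trans A (suc n) (~-sym A (suc n) (proj₂ u)) (proj₂ v))

    quotient-endless : Endless Q
    quotient-endless u@(y , x~y) = let (z , y≤z , y~z , y≁z) = reach n y in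
      (z , ~-trans A (suc n) x~y y~z) , inj₁ y≤z , y≁z ∘ preserve incl n

    quotient-endless-ᵒᵖ : ¬ (∃[ m ] ∀ u → Q ⊢ m ≤ u) → Endless (Q ᵒᵖ)
    quotient-endless-ᵒᵖ no-least u with em {∃[ v ] Q ⊢ v ≤ u × ¬ (C ⊢ u ~[ n ] v)}
    ... | yes r = r
    ... | no ¬r = contradiction (u , u-least) no-least
      where
      u-least : ∀ v → Q ⊢ u ≤ v
      u-least v with TotalOrder.total Q u v | em {C ⊢ u ~[ n ] v}
      ... | inj₁ u≤v | _       = u≤v
      ... | inj₂ _   | yes u~v = inj₂ u~v
      ... | inj₂ v≤u | no  u≁v = contradiction (v , v≤u , u≁v) ¬r

    part : ∀ u → component C n u ≅ component A n (proj₁ u)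
    part = component-component A em n x

    part-covered : ∀ {v u x′ y′} → Covers Q v u → Covers (A /ρ n) x′ y′ →
                   component C n u ≅ component A n y′
    part-covered {u = u} covers covers′ =
      ≅-trans (part u) (covered-≅ n (covers-preserve em incl n covers) covers′)

    -- If y′ is as in covered-≅, then [x]_{n+1} is a sum of copies of [y′]_n and
    -- possibly one initial n-component.
    component-suc : ∀ (t : 𝒮 n) b {x′ y′} → Covers (A /ρ n) x′ y′ → component A n y′ ≅ 𝒜 (t ⌢ b) →
                    (∀ y → ∃[ a ] component A n y ≅ 𝒜 (t ⌢ a)) →
                    ∃[ a ] C ≅ 𝒜 (t ⌢ b ⌢ a)
    component-suc t b covers′ B≅ h with em {∃[ m ] ∀ u → Q ⊢ m ≤ u}
    ... | yes (m , m-least) = inject₁ a₀ , ℕ-Shape-unique em shape (𝒜-ℕ-Shape em₀ n t b a₀)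
      where
      a₀ = proj₁ (h (proj₁ m))
      e = ≅ℕ-chain em Q quotient-finite quotient-endless m m-least

      later : ∀ {u} i → Iso.to e u ≡ i → i ≢ 0 → component C n u ≅ 𝒜 (t ⌢ b)
      later zero    p i≢0 = contradiction refl i≢0
      later (suc i) p _   = ≅-trans (part-covered (covers-from e (covers-ℕ i) p) covers′) B≅

      shape : ℕ-Shape n C (𝒜 (t ⌢ a₀)) (𝒜 (t ⌢ b))
      shape = record
        { quotient = e
        ; initial  = λ u p → ≅-trans
            (component-cong C n (TotalOrder.antisym Q
              (Iso.cancel e (ℕ.≤-trans (ℕ.≤-reflexive p) z≤n)) (m-least u)))
            (≅-trans (part m) (proj₂ (h (proj₁ m))))
        ; later    = λ u → later _ refl
        }
    ... | no no-least = fromℕ (suc n) , proj₁ (ℤ-Shape-unique em shape S (centre A (suc n) x) z)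
      where
      S = 𝒜-ℤ-Shape em₀ n t b
      z = Iso.from (ℤ-Shape.quotient S) 0ℤ
      e = ≅ℤ-chain em Q quotient-finite quotient-endless (quotient-endless-ᵒᵖ no-least)
            (centre A (suc n) x)

      shape : ℤ-Shape n C (𝒜 (t ⌢ b))
      shape = record
        { quotient = e
        ; parts    = λ u → ≅-trans
            (part-covered (covers-from e (covers-ℤ (Iso.to e u)) refl) covers′) B≅
        }

  -- Pastijn's theorem for the components of A, with a sequence t common to
  -- all of them.
  pastijn : ∀ n → Σ[ t ∈ 𝒮 n ] ∀ x → ∃[ a ] component A n x ≅ 𝒜 (t ⌢ a)
  pastijn zero = ⟨⟩ , λ x → zero , mkIso (component A 0 x) 𝟏 (λ _ → tt) (λ _ _ _ → refl)
    (λ (_ , p) (_ , q) _ → A.reflexive (A.Eq.trans (A.Eq.sym p) q))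
    (λ _ → centre A 0 x , refl)
  pastijn (suc n) =
    let (t , h)      = pastijn n
        (y , covers) = next n point
        (b , B≅)     = h y
    in t ⌢ b , λ x → component-suc n x t b covers B≅ h

  -- The embedding sequence of the point; excluded middle decides whether
  -- [point]_{n+1}/n has order type ℕ.
  π-value : ∀ {n} → Dec (∃[ i ] Predecessors A point n i) → ω+1
  π-value (yes (i , _)) = [ i ]
  π-value (no _)        = ω

  π : ℕ → ω+1
  π n = π-value {n} em

  isEmbeddingSequence : IsEmbeddingSequence A point π
  isEmbeddingSequence = record
    { finite   = λ n i → finite n i em
    ; infinite = λ n → infinite n em
    }
    where
    finite : ∀ n i d → π-value {n} d ≡ [ i ] → Predecessors A point n i
    finite n i (yes (_ , h)) refl = h

    infinite : ∀ n d → π-value {n} d ≡ ω → ∀ i → ¬ Predecessors A point n i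
    infinite n (no ¬h) _ i h = ¬h (i , h)

  -- The sequences t n are successive restrictions of each other, and the
  -- component [point]_n is isomorphic to 𝒜(t n ⌢ final n).
  t : ∀ n → 𝒮 n
  t n = proj₁ (pastijn n)

  final : ∀ n → Fin (suc n)
  final n = proj₁ (proj₂ (pastijn n) point)

  top-value : Dec (∃[ m ] IsLeastNullFrom π m) → ω+1
  top-value (yes (m , _)) = [ toℕ (final m) ]
  top-value (no _)        = ω

  -- The trunk of the point.
  σ : 𝒮ω+1
  σ = record
    { at      = λ where
        [ n ] → [ toℕ (last (t (suc n))) ]
        ω     → top-value em₀
    ; bounded = λ where
        [ n ] → [ Fin.toℕ≤pred[n] (last (t (suc n))) ]
        ω     → _ ≤⊤⁺
    }

  isTrunk : IsTrunk A point π σ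
  isTrunk = record
    { s     = λ n → t n ⌢ final n
    ; iso   = λ n → proj₂ (proj₂ (pastijn n) point)
    ; below = below
    ; top   = λ m → top′ m em₀
    ; topω  = topω′ em₀
    }
    where
    below : ∀ n → σ ↾ suc n ≡ t (suc n)
    below zero    = cong (⟨⟩ ⌢_) (lower-≡ {k = last (t 1)} (bounded σ [ 0 ]) refl)
    below (suc n) = cong₂ _⌢_ (below n)
      (lower-≡ {k = last (t (suc (suc n)))} (bounded σ [ suc n ]) refl)

    top′ : ∀ m d → IsLeastNullFrom π m → top-value d ≡ [ toℕ (final m) ]
    top′ m (yes (m′ , null′ , least′)) (null , least)
      with refl ← ℕ.≤-antisym (least m′ null′) (least′ m null) = refl
    top′ m (no ¬p) h = contradiction (m , h) ¬p

    topω′ : ∀ d → (∀ m → ¬ IsLeastNullFrom π m) → top-value d ≡ ω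
    topω′ (yes (m , h)) none = contradiction h (none m)
    topω′ (no _)        _    = refl

mainTheorem5 : ∀ {ℓ} → ExcludedMiddle ℓ →
    (A : Chain ℓ) → Uniform A → HasRank A ω →
    (∃[ σ ] ∃[ π ] Σ[ c ∈ Compatible σ π ] A ≅𝒜[ c ])
    × (∀ (x : ∣ A ∣) (σ : 𝒮ω+1) (π : ℕ → ω+1) →
    IsEmbeddingSequence A x π → IsTrunk A x π σ →
    Σ[ c ∈ Compatible σ π ] A ≅𝒜[ c ])
mainTheorem5 em A uniform rank =
    (σ , π , representation point σ π isEmbeddingSequence isTrunk) , representation
  where
  open UniformChain em A uniform rank

  representation : ∀ x σ π → IsEmbeddingSequence A x π → IsTrunk A x π σ →
                   Σ[ c ∈ Compatible σ π ] A ≅𝒜[ c ]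
  representation x σ π E T = compatible , system , limit-iso (near x)
    where open Trunk em A x E T
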